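{- For every even integer $q\ge 6$, there exists a finite simple triangle-free graph $G_q$ with no $2$-factor such that \[ \tau(G_q)=\frac{2q^2-q-2}{q^2+q}=2-\frac{3q+2}{q^2+q}, \] where $\tau(G_q)$ denotes the toughness of $G_q$.
   Context: All graphs are simple. For a graph $G$, $c(G)$ denotes the number of connected components of $G$, and for $S\subseteq V(G)$, $G-S$ denotes the subgraph of $G$ induced on $V(G)\setminus S$. For a real number $t\ge 0$, $G$ is $t$-tough if $|S|\ge t\cdot c(G-S)$ for every $S\subseteq V(G)$ with $c(G-S)\ge 2$. The toughness $\tau(G)$ is the largest real number $t$ for which $G$ is $t$-tough, or $\infty$ if $G$ is complete. A $2$-factor of $G$ is a spanning $2$-regular subgraph of $G$. A graph is triangle-free if it contains no three pairwise adjacent vertices. -}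

module Defs where

open import Data.Fin using (Fin)
open import Data.Fin.Subset using (Subset; _∈_; ∁; ∣_∣)
open import Data.Integer using (+_)
open import Data.Nat as ℕ using (ℕ; NonZero; >-nonZero; z≤n; s≤s)
import Data.Nat.Properties as ℕ
open import Data.Product using (Σ; Σ-syntax; _×_; proj₁)
open import Data.Rational using (ℚ; 0ℚ; _/_; _*_; _≤_)
open import Data.Vec using (allFin; count)
open import Function.Base using (_on_)
open import Function.Bundles using (Bijection)
open import Level using (0ℓ)
open import Relation.Binary using (Rel; Decidable; Setoid; Symmetric; _⇒_)
open import Relation.Binary.Construct.Closure.ReflexiveTransitive
  using (Star; ε; _◅◅_; reverse)
open import Relation.Binary.PropositionalEquality using (_≡_; _≢_; setoid)
open import Relation.Nullary using (¬_)
open import Relation.Nullary.Construct.Add.Supremum using (_⁺; ⊤⁺; [_])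

-- Simple graphs on the vertex set V.  Finite graphs are those with V = Fin n.
record Graph (V : Set) : Set₁ where
  infix 4 _~_ _~?_
  field
    _~_     : Rel V 0ℓ
    _~?_    : Decidable _~_
    ~-sym   : Symmetric _~_
    ~-irrefl : ∀ {v} → ¬ (v ~ v)

open Graph public using () renaming (_~_ to Adj)

-- The vertices are pairs of v and a proof of v ∈ ∁ S.  Membership in ∁ S is
-- an inductive family with at most one inhabitant, so no vertex is duplicated
-- (this would be unclear for proofs of ¬ (v ∈ S), lacking extensionality).
_∖_ : ∀ {n} → Graph (Fin n) → (S : Subset n) → Graph (Σ[ v ∈ Fin n ] v ∈ ∁ S)
G ∖ S = record
  { _~_      = _~_ on proj₁
  ; _~?_     = λ u v → proj₁ u ~? proj₁ v
  ; ~-sym    = ~-sym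
  ; ~-irrefl = ~-irrefl
  }
  where open Graph G

-- Star (Adj G) u v is the type of walks from u to v, so the equivalence
-- classes of this setoid are the connected components of G.
componentSetoid : ∀ {V} → Graph V → Setoid 0ℓ 0ℓ
componentSetoid {V} G = record
  { Carrier       = V
  ; _≈_           = Star (Adj G)
  ; isEquivalence = record
    { refl  = ε
    ; sym   = reverse (Graph.~-sym G)
    ; trans = _◅◅_
    }
  }

-- HasComponents G k expresses c(G) = k.
HasComponents : ∀ {V} → Graph V → ℕ → Set
HasComponents G k = Bijection (componentSetoid G) (setoid (Fin k))

Tough : ∀ {n} → ℚ → Graph (Fin n) → Set
Tough {n} t G = (S : Subset n) (k : ℕ) → HasComponents (G ∖ S) k → 2 ℕ.≤ k →
                t * (+ k / 1) ≤ + ∣ S ∣ / 1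

Complete : ∀ {V} → Graph V → Set
Complete G = ∀ {u v} → u ≢ v → Adj G u v

-- IsToughness G τ expresses τ(G) = τ, where ⊤⁺ stands for ∞.  Rational t
-- suffice in the maximality clause: if G were t-tough for a real t > r, it
-- would also be t′-tough for every rational t′ with r < t′ < t.
IsToughness : ∀ {n} → Graph (Fin n) → ℚ ⁺ → Set
IsToughness G ⊤⁺    = Complete G
IsToughness G [ r ] =
  0ℚ ≤ r × Tough r G × (∀ t → 0ℚ ≤ t → Tough t G → t ≤ r)

TriangleFree : ∀ {V} → Graph V → Set
TriangleFree G = ∀ u v w → ¬ (u ~ v × v ~ w × u ~ w)
  where open Graph G

degree : ∀ {n} → Graph (Fin n) → Fin n → ℕ
degree {n} G v = count (v ~?_) (allFin n)
  where open Graph G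

-- A spanning subgraph of G is a graph on the same vertex set whose edges are
-- edges of G.
HasTwoFactor : ∀ {n} → Graph (Fin n) → Set₁
HasTwoFactor {n} G =
  Σ[ H ∈ Graph (Fin n) ] (Adj H ⇒ Adj G) × (∀ v → degree H v ≡ 2)

q²+q-nonZero : ∀ {q} → 6 ℕ.≤ q → NonZero (q ℕ.* q ℕ.+ q)
q²+q-nonZero {q} 6≤q =
  >-nonZero (ℕ.≤-trans (ℕ.≤-trans (s≤s z≤n) 6≤q) (ℕ.m≤n+m q (q ℕ.* q)))

{-# OPTIONS --safe #-}

{-
Let a = q/2 − 1.  Take q copies ("blobs") of a large blow-up of a triangle-free
graph in which every independent set I has at least 9/4 ∣I∣ neighbours, an
independent set of a "hubs", and one "link" for each pair of blobs {i, j},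
adjacent to all hubs and to two private vertices ("ports"), one in blob i and
one in blob j.

In a 2-factor the number of edges leaving a blob towards links is even and at
most q − 1, which is odd, so it is at most q − 2.  The q (q − 1) edge ends at
the links would thus number at most 2a + q (q − 2) = q (q − 1) − 2.

Deleting all hubs and ports, a + q (q − 1) vertices, leaves q (q − 1) / 2
isolated links and q blobs; this ratio is the toughness.  To see that no other
set S does better, note first that tearing a blob apart costs so many vertices
that ∣S∣ is at least twice the number of components.  Otherwise each blob is
connected.  If a hub and a link survive, every blob cut off from them costs
about q / 2 vertices; if no link survives, there are at most a + q components;
if no hub survives, k groups of blobs are separated only by cutting
(k − 1)(2q − k) / 2 of the links, and one more deletion per cut link isolates it.
-}
module Submission where

open import Defs
import Algebra.Properties.Semiring.Sum
open import Data.Bool as Bool using (Bool; true; false; not; _∧_; _∨_; if_then_else_)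
import Data.Bool.Properties as Boolₚ
open import Data.Empty using (⊥)
open import Data.Fin using (Fin; zero; suc; _≟_; toℕ; _↑ˡ_; _↑ʳ_; inject₁; splitAt; combine; remQuot)
open import Data.Fin.Induction using (<-weakInduction)
import Data.Fin.Properties as Finₚ
open import Data.Fin.Subset using (Subset; _∈_; ∁; ∣_∣)
open import Data.Integer as ℤ using (ℤ)
import Data.Integer.Properties as ℤₚ
import Data.Integer.Tactic.RingSolver as ℤ-Solver
open import Data.Nat as ℕ using (ℕ; zero; suc; _+_; _*_; _≤_; _≤ᵇ_; ∣_-_∣; z≤n; s≤s; NonZero)
open import Data.Nat.Divisibility using (_∣_; divides)
import Data.Nat.Properties as ℕₚ
open import Data.Nat.Tactic.RingSolver using (solve-∀)
open import Data.Product using (Σ-syntax; ∃-syntax; _×_; _,_; proj₁; proj₂)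
open import Data.Rational as ℚ using (0ℚ; _/_)
import Data.Rational.Properties as ℚₚ
open import Data.Rational.Unnormalised as ℚᵘ using (mkℚᵘ; *≤*; *≡*)
import Data.Rational.Unnormalised.Properties as ℚᵘₚ
open import Data.Sum using (_⊎_; inj₁; inj₂; [_,_]′)
open import Data.Unit using (tt)
open import Data.Vec using (Vec; []; _∷_; lookup; tabulate; count)
import Data.Vec.Properties as Vecₚ
import Data.Vec.Properties.WithK as Vecₚ
open import Function using (_∘_; id; _$_; mk⇔)
open import Function.Bundles using (Bijection)
open import Level using (0ℓ)
open import Relation.Binary using (IsEquivalence; Setoid)
open import Relation.Binary.Construct.Closure.ReflexiveTransitive using (Star; ε; _◅_; fold)
open import Relation.Binary.PropositionalEquality
  using (_≡_; _≢_; refl; sym; trans; cong; cong₂; subst; subst₂; _≗_; module ≡-Reasoning)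
open import Relation.Binary.PropositionalEquality.WithK using (≡-irrelevant)
open import Relation.Nullary using (¬_; ¬?; Dec; yes; no; does; contradiction)
open import Relation.Nullary.Construct.Add.Supremum using ([_])
open import Relation.Nullary.Decidable using (from-yes; dec-true; dec-false; does-⇔)
open import Relation.Unary using (Pred; Decidable)
open Algebra.Properties.Semiring.Sum ℕₚ.+-*-semiring
  using (sum; sum-cong-≗; ∑-distrib-+; ∑-comm; *-distribˡ-sum)

-- Sums over `Fin n` and indicator bits.

sum-mono : ∀ {n} {f g : Fin n → ℕ} → (∀ i → f i ≤ g i) → sum f ≤ sum g
sum-mono {zero}  f≤g = z≤n
sum-mono {suc n} f≤g = ℕₚ.+-mono-≤ (f≤g zero) (sum-mono (f≤g ∘ suc))

sum-const : ∀ n c → sum {n} (λ _ → c) ≡ n * c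
sum-const zero    c = refl
sum-const (suc n) c = cong (c +_) (sum-const n c)

sum-ones : ∀ n → sum {n} (λ _ → 1) ≡ n
sum-ones n = trans (sum-const n 1) (ℕₚ.*-identityʳ n)

sum-↑ : ∀ m {n} (f : Fin (m + n) → ℕ) → sum f ≡ sum (f ∘ (_↑ˡ n)) + sum (f ∘ (m ↑ʳ_))
sum-↑ zero    f = refl
sum-↑ (suc m) f = trans (cong (f zero +_) (sum-↑ m (f ∘ suc))) (sym (ℕₚ.+-assoc (f zero) _ _))

sum-combine : ∀ m {n} (f : Fin (m * n) → ℕ) → sum f ≡ sum (λ i → sum (λ j → f (combine {m} i j)))
sum-combine zero    f = refl
sum-combine (suc m) {n} f =
  trans (sum-↑ n f) (cong (sum (f ∘ (_↑ˡ (m * n))) +_) (sum-combine m (f ∘ (n ↑ʳ_))))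

bit : Bool → ℕ
bit true  = 1
bit false = 0

bit≤1 : ∀ b → bit b ≤ 1
bit≤1 true  = s≤s z≤n
bit≤1 false = z≤n

bit-split : ∀ b → bit b + bit (not b) ≡ 1
bit-split true  = refl
bit-split false = refl

δ : ∀ {n} → Fin n → Fin n → ℕ
δ i j = bit (does (i ≟ j))

δ-refl : ∀ {n} (i : Fin n) → δ i i ≡ 1
δ-refl i with i ≟ i
... | yes _   = refl
... | no  i≢i = contradiction refl i≢i

δ-≢ : ∀ {n} {i j : Fin n} → i ≢ j → δ i j ≡ 0
δ-≢ {i = i} {j} i≢j with i ≟ j
... | yes i≡j = contradiction i≡j i≢j
... | no  _   = refl

sum-δ : ∀ {n} (i : Fin n) → sum (δ i) ≡ 1
sum-δ {suc n} zero    = cong suc (trans (sum-const n 0) (ℕₚ.*-zeroʳ n))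
sum-δ {suc n} (suc i) = sum-δ i

-- Sums over enumerated types.

record Enumerated (V : Set) : Set₁ where
  field
    -- The sum is a field, not defined through `elem`, so that over `⊎` and `×` it unfolds to a sum
    -- of two sums and to a double sum; `∑-elem` ties it to sums over `Fin`.
    ∑          : (V → ℕ) → ℕ
    size       : ℕ
    elem       : Fin size → V
    index      : V → Fin size
    elem-index : ∀ v → elem (index v) ≡ v
    index-elem : ∀ k → index (elem k) ≡ k
    ∑-elem     : ∀ f → ∑ f ≡ sum (f ∘ elem)

open Enumerated {{...}} public

instance
  enumFin : ∀ {n} → Enumerated (Fin n)
  enumFin {n} = record
    { ∑ = sum ; size = n ; elem = id ; index = id
    ; elem-index = λ _ → refl ; index-elem = λ _ → refl ; ∑-elem = λ _ → refl }

  enum⊎ : ∀ {U V} {{_ : Enumerated U}} {{_ : Enumerated V}} → Enumerated (U ⊎ V)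
  enum⊎ {U} {V} {{EU}} {{EV}} = record
    { ∑          = λ f → ∑ (f ∘ inj₁) + ∑ (f ∘ inj₂)
    ; size       = m + n
    ; elem       = to
    ; index      = from
    ; elem-index = to-from
    ; index-elem = λ k → from-to k
    ; ∑-elem     = λ f → sym $ begin
        sum (f ∘ to)
          ≡⟨ sum-↑ m (f ∘ to) ⟩
        sum (f ∘ to ∘ (_↑ˡ n)) + sum (f ∘ to ∘ (m ↑ʳ_))
          ≡⟨ cong₂ _+_ (sum-cong-≗ (λ i → cong (f ∘ [ inj₁ ∘ elem , inj₂ ∘ elem ]′) (Finₚ.splitAt-↑ˡ m i n)))
                       (sum-cong-≗ (λ i → cong (f ∘ [ inj₁ ∘ elem , inj₂ ∘ elem ]′) (Finₚ.splitAt-↑ʳ m n i))) ⟩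
        sum (f ∘ inj₁ ∘ elem) + sum (f ∘ inj₂ ∘ elem)
          ≡⟨ cong₂ _+_ (∑-elem (f ∘ inj₁)) (∑-elem (f ∘ inj₂)) ⟨
        ∑ (f ∘ inj₁) + ∑ (f ∘ inj₂) ∎
    }
    where
    open ≡-Reasoning
    m n : ℕ
    m = size {{EU}}
    n = size {{EV}}
    to : Fin (m + n) → U ⊎ V
    to = [ inj₁ ∘ elem , inj₂ ∘ elem ]′ ∘ splitAt m
    from : U ⊎ V → Fin (m + n)
    from = [ (λ u → index u ↑ˡ n) , (λ v → m ↑ʳ index v) ]′
    to-from : ∀ v → to (from v) ≡ v
    to-from (inj₁ u) rewrite Finₚ.splitAt-↑ˡ m (index u) n = cong inj₁ (elem-index u)
    to-from (inj₂ v) rewrite Finₚ.splitAt-↑ʳ m n (index v) = cong inj₂ (elem-index v)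
    from-to : ∀ k → from (to k) ≡ k
    from-to k with splitAt m k in eq
    ... | inj₁ i = trans (cong (_↑ˡ n) (index-elem {U} i)) (Finₚ.splitAt⁻¹-↑ˡ eq)
    ... | inj₂ j = trans (cong (m ↑ʳ_) (index-elem {V} j)) (Finₚ.splitAt⁻¹-↑ʳ eq)

  enum× : ∀ {U V} {{_ : Enumerated U}} {{_ : Enumerated V}} → Enumerated (U × V)
  enum× {U} {V} {{EU}} {{EV}} = record
    { ∑          = λ f → ∑ (λ u → ∑ (λ v → f (u , v)))
    ; size       = m * n
    ; elem       = to
    ; index      = from
    ; elem-index = to-from
    ; index-elem = from-to
    ; ∑-elem     = λ f → sym $ begin
        sum (f ∘ to)
          ≡⟨ sum-combine m (f ∘ to) ⟩
        sum (λ i → sum (λ j → f (to (combine {m} i j))))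
          ≡⟨ sum-cong-≗ (λ i → sum-cong-≗ (λ j →
               cong (λ (k , l) → f (elem k , elem l)) (Finₚ.remQuot-combine {m} {n} i j))) ⟩
        sum (λ i → sum (λ j → f (elem i , elem j)))
          ≡⟨ sum-cong-≗ (λ i → ∑-elem (λ v → f (elem i , v))) ⟨
        sum (λ i → ∑ (λ v → f (elem i , v)))
          ≡⟨ ∑-elem (λ u → ∑ (λ v → f (u , v))) ⟨
        ∑ (λ u → ∑ (λ v → f (u , v))) ∎
    }
    where
    open ≡-Reasoning
    m n : ℕ
    m = size {{EU}}
    n = size {{EV}}
    to : Fin (m * n) → U × V
    to k = let (i , j) = remQuot {m} n k in elem i , elem j
    from : U × V → Fin (m * n)
    from (u , v) = combine (index u) (index v)
    to-from : ∀ v → to (from v) ≡ v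
    to-from (u , v) = trans
      (cong (λ (k , l) → elem k , elem l) (Finₚ.remQuot-combine {m} {n} (index u) (index v)))
      (cong₂ _,_ (elem-index u) (elem-index v))
    from-to : ∀ k → from (to k) ≡ k
    from-to k = trans (cong₂ combine (index-elem {U} _) (index-elem {V} _)) (Finₚ.combine-remQuot {m} n k)

transport : ∀ {U V : Set} {{_ : Enumerated U}} (to : U → V) (from : V → U) →
            (∀ v → to (from v) ≡ v) → (∀ u → from (to u) ≡ u) → Enumerated V
transport {U} to from to-from from-to = record
  { ∑ = λ f → ∑ (f ∘ to) ; size = size {U} ; elem = to ∘ elem {U} ; index = index ∘ from
  ; elem-index = λ v → trans (cong to (elem-index (from v))) (to-from v)
  ; index-elem = λ k → trans (cong index (from-to (elem {U} k))) (index-elem {U} k)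
  ; ∑-elem = λ f → ∑-elem (f ∘ to) }

module _ {V : Set} {{EV : Enumerated V}} where

  ∑-cong : {f g : V → ℕ} → f ≗ g → ∑ f ≡ ∑ g
  ∑-cong {f} {g} f≗g =
    trans (∑-elem f) (trans (sum-cong-≗ (f≗g ∘ elem)) (sym (∑-elem g)))

  ∑-mono : {f g : V → ℕ} → (∀ v → f v ≤ g v) → ∑ f ≤ ∑ g
  ∑-mono {f} {g} f≤g rewrite ∑-elem f | ∑-elem g = sum-mono (f≤g ∘ elem)

  ∑-+ : (f g : V → ℕ) → ∑ (λ v → f v + g v) ≡ ∑ f + ∑ g
  ∑-+ f g rewrite ∑-elem f | ∑-elem g | ∑-elem (λ v → f v + g v) = ∑-distrib-+ (f ∘ elem) (g ∘ elem)

  ∑-* : ∀ c (f : V → ℕ) → ∑ (λ v → c * f v) ≡ c * ∑ f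
  ∑-* c f rewrite ∑-elem f | ∑-elem (λ v → c * f v) = sym (*-distribˡ-sum c (f ∘ elem))

  ∑-const : ∀ c → ∑ (λ (_ : V) → c) ≡ size {V} * c
  ∑-const c = trans (∑-elem {V} (λ _ → c)) (sum-const (size {V}) c)

  ∑-zero : {f : V → ℕ} → (∀ v → f v ≡ 0) → ∑ f ≡ 0
  ∑-zero f≡0 = trans (∑-cong f≡0) (trans (∑-const 0) (ℕₚ.*-zeroʳ (size {V})))

∑-swap : ∀ {U V : Set} {{_ : Enumerated U}} {{_ : Enumerated V}} (f : U → V → ℕ) →
         ∑ (λ u → ∑ (λ v → f u v)) ≡ ∑ (λ v → ∑ (λ u → f u v))
∑-swap {U} {V} f = begin
  ∑ (λ u → ∑ (λ v → f u v))                      ≡⟨ ∑-elem (λ u → ∑ (f u)) ⟩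
  sum (λ i → ∑ (λ v → f (elem {U} i) v))             ≡⟨ sum-cong-≗ (λ i → ∑-elem (f (elem {U} i))) ⟩
  sum (λ i → sum (λ j → f (elem {U} i) (elem {V} j)))    ≡⟨ ∑-comm (λ i j → f (elem {U} i) (elem {V} j)) ⟩
  sum (λ j → sum (λ i → f (elem {U} i) (elem {V} j)))    ≡⟨ sum-cong-≗ (λ j → ∑-elem (λ u → f u (elem {V} j))) ⟨
  sum (λ j → ∑ (λ u → f u (elem {V} j)))             ≡⟨ ∑-elem (λ v → ∑ (λ u → f u v)) ⟨
  ∑ (λ v → ∑ (λ u → f u v))                      ∎
  where open ≡-Reasoning

-- Counting by covering.

sum-δ-injective≤ : ∀ {c n} (g : Fin c → Fin n) → (∀ {γ γ′} → g γ ≡ g γ′ → γ ≡ γ′) →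
                   (w : Fin n → ℕ) → (∀ γ → 1 ≤ w (g γ)) → ∀ k → sum (λ γ → δ (g γ) k) ≤ w k
sum-δ-injective≤ {c} g g-inj w w≥1 k with Finₚ.any? (λ γ → g γ ≟ k)
... | no ∄γ = ℕₚ.≤-trans (ℕₚ.≤-reflexive (∑-zero (λ γ → δ-≢ (λ eq → ∄γ (γ , eq))))) z≤n
-- Here k is `g γ₀`, and injectivity leaves `γ₀` as the only index that contributes.
... | yes (γ₀ , refl) = ℕₚ.≤-trans (ℕₚ.≤-reflexive (trans (sum-cong-≗ δ-inj) (sum-δ γ₀))) (w≥1 γ₀)
  where
  δ-inj : ∀ γ → δ (g γ) (g γ₀) ≡ δ γ₀ γ
  δ-inj γ with γ₀ ≟ γ
  ... | yes refl = δ-refl (g γ)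
  ... | no  γ₀≢γ = δ-≢ (λ eq → γ₀≢γ (sym (g-inj eq)))

-- Different γ have different witnesses, since an l belongs to at most one γ, so the witnesses alone
-- contribute at least c to the weight. The upper bounds on numbers of components below are
-- instances, with l ranging over hubs, links, blobs or classes.
cover : ∀ {L : Set} {{_ : Enumerated L}} {c} (w : L → ℕ) (_∼_ : L → Fin c → Set) →
        (∀ {l γ γ′} → l ∼ γ → l ∼ γ′ → γ ≡ γ′) →
        (∀ γ → ∃[ l ] 1 ≤ w l × l ∼ γ) → c ≤ ∑ w
cover {L} {c} w _∼_ functional hit = begin
  c                                               ≡⟨ sum-ones c ⟨
  sum {c} (λ _ → 1)                               ≡⟨ sum-cong-≗ (λ γ → sum-δ (g γ)) ⟨
  sum (λ γ → sum (δ (g γ)))                       ≡⟨ ∑-comm (λ γ → δ (g γ)) ⟩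
  sum (λ k → sum (λ γ → δ (g γ) k))               ≤⟨ sum-mono (sum-δ-injective≤ g g-inj (w ∘ elem {L}) w≥1) ⟩
  sum (w ∘ elem {L})                                  ≡⟨ ∑-elem w ⟨
  ∑ w                                             ∎
  where
  open ℕₚ.≤-Reasoning
  g : Fin c → Fin (size {L})
  g γ = index (proj₁ (hit γ))
  elem-g : ∀ γ → elem (g γ) ≡ proj₁ (hit γ)
  elem-g γ = elem-index (proj₁ (hit γ))
  g-inj : ∀ {γ γ′} → g γ ≡ g γ′ → γ ≡ γ′
  g-inj {γ} {γ′} eq = functional (proj₂ (proj₂ (hit γ)))
    (subst (_∼ γ′) (trans (sym (elem-g γ′)) (trans (cong elem (sym eq)) (elem-g γ))) (proj₂ (proj₂ (hit γ′))))
  w≥1 : ∀ γ → 1 ≤ w (elem (g γ))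
  w≥1 γ = subst (λ l → 1 ≤ w l) (sym (elem-g γ)) (proj₁ (proj₂ (hit γ)))

-- Unordered pairs.

data Pair : ℕ → Set where
  first : ∀ {n} → Fin n → Pair (suc n)
  later : ∀ {n} → Pair n → Pair (suc n)

-- Each two-element subset is encoded exactly once: `first j` is {0, j + 1}, and `later p` is p
-- shifted by one. The recursion follows that of sums over `Fin n`.
lo hi : ∀ {n} → Pair n → Fin n
lo (first j) = zero
lo (later p) = suc (lo p)
hi (first j) = suc j
hi (later p) = suc (hi p)

lo≢hi : ∀ {n} (p : Pair n) → lo p ≢ hi p
lo≢hi (first j) ()
lo≢hi (later p) eq = lo≢hi p (Finₚ.suc-injective eq)

instance
  enumPair : ∀ {n} → Enumerated (Pair n)
  enumPair {zero} = record
    { ∑ = λ _ → 0 ; size = 0 ; elem = λ () ; index = λ ()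
    ; elem-index = λ () ; index-elem = λ () ; ∑-elem = λ _ → refl }
  enumPair {suc n} = transport {Fin n ⊎ Pair n} {{enum⊎ {{enumFin}} {{enumPair {n}}}}}
    [ first , later ]′
    (λ { (first j) → inj₁ j ; (later p) → inj₂ p })
    (λ { (first j) → refl ; (later p) → refl })
    (λ { (inj₁ j) → refl ; (inj₂ p) → refl })

-- By induction, splitting the square into its corner, first row, first column and a smaller square.
-- A symmetric matrix gives a parity statement, constant rows a count of endpoints, and the ports
-- are the off-diagonal part of a q × q array.
sum²-pairs : ∀ {n} (g : Fin n → Fin n → ℕ) →
             sum (λ i → sum (g i)) ≡ ∑ (λ p → g (lo p) (hi p) + g (hi p) (lo p)) + sum (λ i → g i i)
sum²-pairs {zero}  g = refl
sum²-pairs {suc n} g = begin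
  (g₀₀ + row) + sum (λ i → g (suc i) zero + sum (g (suc i) ∘ suc))
    ≡⟨ cong ((g₀₀ + row) +_) (∑-distrib-+ (λ i → g (suc i) zero) (λ i → sum (g (suc i) ∘ suc))) ⟩
  (g₀₀ + row) + (column + sum (λ i → sum (g (suc i) ∘ suc)))
    ≡⟨ cong (λ s → (g₀₀ + row) + (column + s)) (sum²-pairs (λ i j → g (suc i) (suc j))) ⟩
  (g₀₀ + row) + (column + (inner + diagonal))
    ≡⟨ rearrange g₀₀ row column inner diagonal ⟩
  ((row + column) + inner) + (g₀₀ + diagonal)
    ≡⟨ cong (λ s → (s + inner) + (g₀₀ + diagonal)) (∑-distrib-+ (λ j → g zero (suc j)) (λ j → g (suc j) zero)) ⟨
  (sum (λ j → g zero (suc j) + g (suc j) zero) + inner) + (g₀₀ + diagonal) ∎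
  where
  open ≡-Reasoning
  g₀₀ row column inner diagonal : ℕ
  g₀₀      = g zero zero
  row      = sum (λ j → g zero (suc j))
  column   = sum (λ i → g (suc i) zero)
  inner    = ∑ (λ p → g (suc (lo p)) (suc (hi p)) + g (suc (hi p)) (suc (lo p)))
  diagonal = sum (λ i → g (suc i) (suc i))
  rearrange : ∀ a b c d e → (a + b) + (c + (d + e)) ≡ ((b + c) + d) + (a + e)
  rearrange = solve-∀

-- Each index is an end of n - 1 pairs; the extra `sum f` is the diagonal of the matrix with
-- constant rows and avoids a subtraction.
∑-endpoints : ∀ {n} (f : Fin n → ℕ) → ∑ (λ p → f (lo p) + f (hi p)) + sum f ≡ n * sum f
∑-endpoints {n} f = trans (sym (sum²-pairs (λ i _ → f i)))
  (trans (sum-cong-≗ (λ i → sum-const n (f i))) (trans (∑-* n f) refl))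

-- Distinct values and separated pairs.

fresh : ∀ {n c} → (Fin n → Fin c) → Fin n → Bool
fresh κ zero    = not (does (Finₚ.any? (λ j → κ (suc j) ≟ κ zero)))
fresh κ (suc i) = fresh (κ ∘ suc) i

-- `fresh` marks the last index at which each value occurs, so this is the size of the image of `κ`.
distinct : ∀ {n c} → (Fin n → Fin c) → ℕ
distinct κ = sum (bit ∘ fresh κ)

fresh-hit : ∀ {n c} (κ : Fin n → Fin c) i → ∃[ j ] fresh κ j ≡ true × κ j ≡ κ i
fresh-hit κ (suc i) with fresh-hit (κ ∘ suc) i
... | j , j-fresh , eq = suc j , j-fresh , eq
fresh-hit κ zero with Finₚ.any? (λ j → κ (suc j) ≟ κ zero) in eq
... | no  _        = zero , cong (not ∘ does) eq , refl
... | yes (i , κi) with fresh-hit (κ ∘ suc) i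
...   | j , j-fresh , eq′ = suc j , j-fresh , trans eq′ κi

_≢ᵇ_ : ∀ {c} → Fin c → Fin c → ℕ
γ ≢ᵇ γ′ = bit (not (does (γ ≟ γ′)))

≢ᵇ-≢ : ∀ {c} {γ γ′ : Fin c} → γ ≢ γ′ → γ ≢ᵇ γ′ ≡ 1
≢ᵇ-≢ {γ = γ} {γ′} neq with γ ≟ γ′
... | yes eq = contradiction eq neq
... | no  _  = refl

distinct≤n : ∀ {n c} (κ : Fin n → Fin c) → distinct κ ≤ n
distinct≤n {n} κ = ℕₚ.≤-trans (sum-mono (bit≤1 ∘ fresh κ))
  (ℕₚ.≤-reflexive (sum-ones n))

distinct≥1 : ∀ {n c} (κ : Fin n → Fin c) → 1 ≤ n → 1 ≤ distinct κ
distinct≥1 {suc zero}    κ _ = s≤s z≤n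
distinct≥1 {suc (suc n)} κ _ =
  ℕₚ.≤-trans (distinct≥1 (κ ∘ suc) (s≤s z≤n)) (ℕₚ.m≤n+m _ (bit (fresh κ zero)))

-- Each value other than `γ` occurs at some index counted on the right; the `suc` accounts for `γ`
-- itself.
distinct≤differ : ∀ {n c} (κ : Fin n → Fin c) γ → distinct κ ≤ suc (sum (λ j → γ ≢ᵇ κ j))
distinct≤differ {zero}  κ γ = z≤n
distinct≤differ {suc n} κ γ with γ ≟ κ zero | Finₚ.any? (λ j → κ (suc j) ≟ κ zero)
... | no  _    | yes _ = ℕₚ.≤-trans (distinct≤differ (κ ∘ suc) γ) (ℕₚ.n≤1+n _)
... | no  _    | no  _ = s≤s (distinct≤differ (κ ∘ suc) γ)
... | yes refl | yes _ = distinct≤differ (κ ∘ suc) γ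
... | yes refl | no ∄j = s≤s (ℕₚ.≤-trans (distinct≤n (κ ∘ suc)) (ℕₚ.≤-reflexive (sym all-differ)))
  where
  all-differ : sum (λ j → κ zero ≢ᵇ κ (suc j)) ≡ n
  all-differ = trans (sum-cong-≗ (λ j → ≢ᵇ-≢ (λ eq → ∄j (j , sym eq))))
    (sum-ones n)

-- (k − 1)(2n − k) / 2 pairs are separated, with both sides moved so that no
-- subtraction occurs.
separated-pairs : ∀ {n c} (κ : Fin n → Fin c) →
  2 * n * distinct κ + distinct κ ≤
  2 * ∑ (λ p → κ (lo p) ≢ᵇ κ (hi p)) + distinct κ * distinct κ + 2 * n
separated-pairs {zero}  κ = z≤n
separated-pairs {suc n} κ with Finₚ.any? (λ j → κ (suc j) ≟ κ zero)
-- Index zero repeats a value: k stays the same, and at least k - 1 later indices have another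
-- value, which is the growth of (k - 1)(2n - k) / 2.
... | yes _ = begin
  2 * suc n * k + k                                 ≡⟨ lhs n k ⟩
  (2 * n * k + k) + 2 * k                           ≤⟨ ℕₚ.+-mono-≤ (separated-pairs (κ ∘ suc))
                                                         (ℕₚ.*-monoʳ-≤ 2 (distinct≤differ (κ ∘ suc) (κ zero))) ⟩
  (2 * x + k * k + 2 * n) + 2 * suc d               ≡⟨ rhs x k n d ⟩
  2 * (d + x) + k * k + 2 * suc n                   ∎
  where
  open ℕₚ.≤-Reasoning
  k d x : ℕ
  k = distinct (κ ∘ suc)
  d = sum (λ j → κ zero ≢ᵇ κ (suc j))
  x = ∑ (λ p → κ (suc (lo p)) ≢ᵇ κ (suc (hi p)))
  lhs : ∀ n k → 2 * suc n * k + k ≡ (2 * n * k + k) + 2 * k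
  lhs = solve-∀
  rhs : ∀ x k n d → (2 * x + k * k + 2 * n) + 2 * suc d ≡ 2 * (d + x) + k * k + 2 * suc n
  rhs = solve-∀
-- The value at index zero is new: k grows by one and all n later indices differ, again exactly the
-- growth of the bound.
... | no ∄j = begin
  2 * suc n * suc k + suc k                         ≡⟨ lhs n k ⟩
  (2 * n * k + k) + (2 * n + 2 * k + 3)             ≤⟨ ℕₚ.+-monoˡ-≤ _ (separated-pairs (κ ∘ suc)) ⟩
  (2 * x + k * k + 2 * n) + (2 * n + 2 * k + 3)     ≡⟨ rhs x k n ⟩
  2 * (n + x) + suc k * suc k + 2 * suc n           ≡⟨ cong (λ d → 2 * (d + x) + suc k * suc k + 2 * suc n) all-differ ⟨
  2 * (d + x) + suc k * suc k + 2 * suc n           ∎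
  where
  open ℕₚ.≤-Reasoning
  k d x : ℕ
  k = distinct (κ ∘ suc)
  d = sum (λ j → κ zero ≢ᵇ κ (suc j))
  x = ∑ (λ p → κ (suc (lo p)) ≢ᵇ κ (suc (hi p)))
  all-differ : d ≡ n
  all-differ = trans (sum-cong-≗ (λ j → ≢ᵇ-≢ (λ eq → ∄j (j , sym eq))))
    (sum-ones n)
  lhs : ∀ n k → 2 * suc n * suc k + suc k ≡ (2 * n * k + k) + (2 * n + 2 * k + 3)
  lhs = solve-∀
  rhs : ∀ x k n → (2 * x + k * k + 2 * n) + (2 * n + 2 * k + 3) ≡ 2 * (n + x) + suc k * suc k + 2 * suc n
  rhs = solve-∀

-- Exhaustive evaluation and the base graph.

exists : ∀ {n} → (Fin n → Bool) → Bool
exists {zero}  f = false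
exists {suc n} f = f zero ∨ exists (f ∘ suc)

exists-true : ∀ {n} (f : Fin n → Bool) → exists f ≡ true → ∃[ i ] f i ≡ true
exists-true {suc n} f eq with f zero in eq₀
... | true  = zero , eq₀
... | false with exists-true (f ∘ suc) eq
...   | i , fi = suc i , fi

exists-false : ∀ {n} (f : Fin n → Bool) → exists f ≡ false → ∀ i → f i ≡ false
exists-false {suc n} f eq i with f zero in eq₀
exists-false {suc n} f eq zero    | false = eq₀
exists-false {suc n} f eq (suc i) | false = exists-false (f ∘ suc) eq i

exists-cong : ∀ {n} {f g : Fin n → Bool} → f ≗ g → exists f ≡ exists g
exists-cong {zero}  f≗g = refl
exists-cong {suc n} f≗g = cong₂ _∨_ (f≗g zero) (exists-cong (f≗g ∘ suc))

-- The quantifier is Boolean, so that a property of all 2ⁿ subsets is proved by a single evaluation.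
allVec : ∀ n → (Vec Bool n → Bool) → Bool
allVec zero    P = P []
allVec (suc n) P = allVec n (P ∘ (true ∷_)) ∧ allVec n (P ∘ (false ∷_))

allVec-sound : ∀ n P → Bool.T (allVec n P) → ∀ W → Bool.T (P W)
allVec-sound zero    P all []          = all
allVec-sound (suc n) P all (b ∷ W) with allVec n (P ∘ (true ∷_)) in eq
allVec-sound (suc n) P all (true  ∷ W) | true = allVec-sound n (P ∘ (true ∷_)) (subst Bool.T (sym eq) tt) W
allVec-sound (suc n) P all (false ∷ W) | true = allVec-sound n (P ∘ (false ∷_)) all W

-- circ is the circulant graph on ℤ/13 with differences ±1 and ±5, the extremal
-- graph for the Ramsey number R(3,5) = 14.
jump : ℕ → Bool
jump 1  = true
jump 5  = true
jump 8  = true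
jump 12 = true
jump _  = false

circ : Fin 13 → Fin 13 → Bool
circ x y = jump ∣ toℕ x - toℕ y ∣

circ-sym : ∀ x y → circ x y ≡ circ y x
circ-sym x y = cong jump (ℕₚ.∣-∣-comm (toℕ x) (toℕ y))

circ-irrefl : ∀ x → circ x x ≡ false
circ-irrefl x = cong jump (ℕₚ.∣n-n∣≡0 (toℕ x))

circ-triangle-free : ∀ x y z → circ x y ≡ true → circ y z ≡ true → circ x z ≡ false
circ-triangle-free x y z xy yz = Boolₚ.¬-not (λ xz → T-elim
  (subst (λ b → Bool.T (not b)) (cong₂ _∧_ xy (cong₂ _∧_ yz xz)) (triangles x y z)))
  where
  T-elim : Bool.T false → ⊥
  T-elim ()
  triangles : ∀ x y z → Bool.T (not (circ x y ∧ (circ y z ∧ circ x z)))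
  triangles = from-yes (Finₚ.all? λ x → Finₚ.all? λ y → Finₚ.all? λ z →
    Bool.T? (not (circ x y ∧ (circ y z ∧ circ x z))))

isolated : ∀ {n} → (Fin n → Fin n → Bool) → (Fin n → Bool) → Fin n → Bool
isolated _~_ W x = W x ∧ not (exists (λ y → (x ~ y) ∧ W y))

-- The isolated vertices of `W` form an independent set whose neighbours all lie outside `W`.
-- Conversely, an independent set I is isolated in the complement of its neighbourhood. Quantified
-- over `W`, this therefore says that I has at least 9/4 ∣I∣ neighbours, in the form in which
-- deletions use it.
Sparse : ∀ {n} → (Fin n → Fin n → Bool) → (Fin n → Bool) → Set
Sparse _~_ W = 9 * sum (bit ∘ isolated _~_ W) ≤ 4 * sum (bit ∘ not ∘ W)

-- `disjoint`, `disjointRows` and `missing` recompute the two sides of `Sparse` by recursion on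
-- vectors, for the evaluation over all subsets.
disjoint : ∀ {n} → Vec Bool n → Vec Bool n → Bool
disjoint []          []          = true
disjoint (false ∷ V) (_     ∷ W) = disjoint V W
disjoint (true  ∷ V) (false ∷ W) = disjoint V W
disjoint (true  ∷ V) (true  ∷ W) = false

disjoint-lookup : ∀ {n} (V W : Vec Bool n) → disjoint V W ≡ not (exists (λ y → lookup V y ∧ lookup W y))
disjoint-lookup []          []          = refl
disjoint-lookup (false ∷ V) (_     ∷ W) = disjoint-lookup V W
disjoint-lookup (true  ∷ V) (false ∷ W) = disjoint-lookup V W
disjoint-lookup (true  ∷ V) (true  ∷ W) = refl

disjointRows : ∀ {m n} → Vec (Vec Bool m) n → Vec Bool n → Vec Bool m → ℕ
disjointRows []      []          W = 0
disjointRows (R ∷ M) (false ∷ V) W = disjointRows M V W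
disjointRows (R ∷ M) (true  ∷ V) W = if disjoint R W then suc (disjointRows M V W) else disjointRows M V W

disjointRows-sum : ∀ {m n} (M : Vec (Vec Bool m) n) V W →
                   disjointRows M V W ≡ sum (λ x → bit (lookup V x ∧ disjoint (lookup M x) W))
disjointRows-sum []      []          W = refl
disjointRows-sum (R ∷ M) (false ∷ V) W = disjointRows-sum M V W
disjointRows-sum (R ∷ M) (true  ∷ V) W with disjoint R W
... | true  = cong suc (disjointRows-sum M V W)
... | false = disjointRows-sum M V W

missing : ∀ {n} → Vec Bool n → ℕ
missing []          = 0
missing (true  ∷ W) = missing W
missing (false ∷ W) = suc (missing W)

missing-sum : ∀ {n} (W : Vec Bool n) → missing W ≡ sum (bit ∘ not ∘ lookup W)
missing-sum []          = refl
missing-sum (true  ∷ W) = missing-sum W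
missing-sum (false ∷ W) = cong suc (missing-sum W)

adjacency : ∀ {n} → (Fin n → Fin n → Bool) → Vec (Vec Bool n) n
adjacency _~_ = tabulate (λ x → tabulate (x ~_))

-- Taking the matrix as an argument lets the 2ⁿ evaluations share its entries.
allSparse : ∀ {n} → Vec (Vec Bool n) n → Bool
allSparse {n} M = allVec n (λ W → 9 * disjointRows M W W ≤ᵇ 4 * missing W)

allSparse-sound : ∀ {n} (_~_ : Fin n → Fin n → Bool) → Bool.T (allSparse (adjacency _~_)) → ∀ W → Sparse _~_ W
allSparse-sound {n} _~_ all W = subst₂ (λ k l → 9 * k ≤ 4 * l)
  (trans (disjointRows-sum (adjacency _~_) V V) (sum-cong-≗ (λ x →
    cong bit (cong₂ _∧_ (V≗ x) (trans (disjoint-lookup (lookup (adjacency _~_) x) V)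
      (cong not (exists-cong (λ y → cong₂ _∧_
        (trans (cong (λ R → lookup R y) (Vecₚ.lookup∘tabulate (λ x → tabulate (x ~_)) x)) (Vecₚ.lookup∘tabulate (x ~_) y))
        (V≗ y)))))))))
  (trans (missing-sum V) (sum-cong-≗ (cong (bit ∘ not) ∘ V≗)))
  (ℕₚ.≤ᵇ⇒≤ _ _ (allVec-sound n _ all V))
  where
  V : Vec Bool n
  V = tabulate W
  V≗ : lookup V ≗ W
  V≗ = Vecₚ.lookup∘tabulate W

Adjacent : ∀ {n} → (Fin n → Fin n → Bool) → Fin n → Fin n → Set
Adjacent _~_ x y = x ~ y ≡ true

-- The interface through which the network sees its base graph. `root` is the class that will hold
-- the ports; `connected` and `neighbour` keep a blob in one piece as long as every class has a
-- survivor.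
record SparseGraph (k : ℕ) : Set where
  field
    _~ᵇ_          : Fin k → Fin k → Bool
    ~ᵇ-sym        : ∀ x y → x ~ᵇ y ≡ y ~ᵇ x
    ~ᵇ-irrefl     : ∀ x → x ~ᵇ x ≡ false
    triangle-free : ∀ x y z → x ~ᵇ y ≡ true → y ~ᵇ z ≡ true → x ~ᵇ z ≡ false
    root          : Fin k
    connected     : ∀ x → Star (Adjacent _~ᵇ_) x root
    neighbour     : ∀ x → ∃[ y ] x ~ᵇ y ≡ true
    sparse        : ∀ W → Sparse _~ᵇ_ W

circulant : SparseGraph 13
circulant = record
  { _~ᵇ_          = circ
  ; ~ᵇ-sym        = circ-sym
  ; ~ᵇ-irrefl     = circ-irrefl
  ; triangle-free = circ-triangle-free
  ; root          = zero
  -- Consecutive residues differ by 1, so a path descends from x to zero.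
  ; connected     = <-weakInduction (λ x → Star (Adjacent circ) x zero) ε (λ x path → step x ◅ path)
  ; neighbour     = from-yes (Finₚ.all? (λ x → Finₚ.any? (λ y → circ x y Bool.≟ true)))
  -- `tt` is accepted because the check of all 2¹³ subsets evaluates to `true`.
  ; sparse        = allSparse-sound circ tt
  }
  where
  step : ∀ x → circ (suc x) (inject₁ x) ≡ true
  step = from-yes (Finₚ.all? (λ x → circ (suc x) (inject₁ x) Bool.≟ true))

-- Indicators, parity and counts of pairs.

bit-∨≤ : ∀ b c → bit (b ∨ c) ≤ bit b + bit c
bit-∨≤ true  c = s≤s z≤n
bit-∨≤ false c = ℕₚ.≤-refl

bit-∧ : ∀ b c → bit (b ∧ c) ≡ bit b * bit c
bit-∧ true  c = sym (ℕₚ.+-identityʳ (bit c))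
bit-∧ false c = refl

bit-mono : ∀ {b c} → (b ≡ true → c ≡ true) → bit b ≤ bit c
bit-mono {false}        imp = z≤n
bit-mono {true} {true}  imp = s≤s z≤n
bit-mono {true} {false} imp = contradiction (imp refl) λ ()

does-true : ∀ {A : Set} (A? : Dec A) → does A? ≡ true → A
does-true (yes a) _ = a

∧-true : ∀ {b c} → b ∧ c ≡ true → b ≡ true × c ≡ true
∧-true {true} {true} _ = refl , refl

∨-true : ∀ {b c} → b ∨ c ≡ true → b ≡ true ⊎ c ≡ true
∨-true {true}         _ = inj₁ refl
∨-true {false} {true} _ = inj₂ refl

count-tabulate : ∀ {A : Set} {P : Pred A 0ℓ} (P? : Decidable P) {n} (f : Fin n → A) →
                 count P? (tabulate f) ≡ sum (λ i → bit (does (P? (f i))))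
count-tabulate P? {zero}  f = refl
count-tabulate P? {suc n} f with does (P? (f zero))
... | true  = cong suc (count-tabulate P? (f ∘ suc))
... | false = count-tabulate P? (f ∘ suc)

sum-single : ∀ {n} (f : Fin n → ℕ) i → (∀ j → j ≢ i → f j ≡ 0) → sum f ≡ f i
sum-single {suc n} f zero others =
  trans (cong (f zero +_) (∑-zero (λ j → others (suc j) λ ()))) (ℕₚ.+-identityʳ (f zero))
sum-single {suc n} f (suc i) others =
  cong₂ _+_ (others zero λ ()) (sum-single (f ∘ suc) i (λ j j≢i → others (suc j) (j≢i ∘ Finₚ.suc-injective)))

-- The handshake lemma: with zero diagonal, a symmetric matrix sums to twice its upper triangle.
∑²-symmetric : ∀ {V : Set} {{_ : Enumerated V}} (g : V → V → ℕ) →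
               (∀ u v → g u v ≡ g v u) → (∀ v → g v v ≡ 0) →
               ∃[ e ] ∑ (λ u → ∑ (g u)) ≡ e * 2
∑²-symmetric {V} g g-sym g-diag = ∑ upper , (begin
  ∑ (λ u → ∑ (g u))                           ≡⟨ ∑-elem (λ u → ∑ (g u)) ⟩
  sum (λ i → ∑ (g (elem {V} i)))              ≡⟨ sum-cong-≗ (λ i → ∑-elem (g (elem {V} i))) ⟩
  sum (λ i → sum (λ j → g (elem {V} i) (elem {V} j)))
    ≡⟨ sum²-pairs (λ i j → g (elem {V} i) (elem {V} j)) ⟩
  ∑ (λ p → upper p + g (elem {V} (hi p)) (elem {V} (lo p))) + sum (λ i → g (elem {V} i) (elem {V} i))
    ≡⟨ cong₂ _+_ (∑-cong (λ p → cong (upper p +_) (g-sym _ _))) (∑-zero (λ i → g-diag (elem {V} i))) ⟩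
  ∑ (λ p → upper p + upper p) + 0             ≡⟨ cong (_+ 0) (∑-+ upper upper) ⟩
  ∑ upper + ∑ upper + 0                       ≡⟨ double (∑ upper) ⟩
  ∑ upper * 2                                 ∎)
  where
  open ≡-Reasoning
  upper : Pair (size {V}) → ℕ
  upper p = g (elem {V} (lo p)) (elem {V} (hi p))
  double : ∀ e → e + e + 0 ≡ e * 2
  double = solve-∀

pair-count : ∀ q → 2 * ∑ (λ (_ : Pair q) → 1) + q ≡ q * q
pair-count q = begin
  2 * ∑ {Pair q} (λ _ → 1) + q                       ≡⟨ cong₂ _+_ (sym (∑-* 2 (λ (_ : Pair q) → 1))) (sym (sum-ones q)) ⟩
  ∑ {Pair q} (λ _ → 2) + sum {q} (λ _ → 1)          ≡⟨ ∑-endpoints {q} (λ _ → 1) ⟩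
  q * sum {q} (λ _ → 1)                              ≡⟨ cong (q *_) (sum-ones q) ⟩
  q * q                                              ∎
  where open ≡-Reasoning

∑-endpoints-δ : ∀ {n} (i : Fin n) → suc (∑ (λ p → δ i (lo p) + δ i (hi p))) ≡ n
∑-endpoints-δ {n} i = begin
  suc (∑ (λ p → δ i (lo p) + δ i (hi p)))               ≡⟨ ℕₚ.+-comm 1 _ ⟩
  ∑ (λ p → δ i (lo p) + δ i (hi p)) + 1                 ≡⟨ cong (∑ (λ p → δ i (lo p) + δ i (hi p)) +_) (sum-δ i) ⟨
  ∑ (λ p → δ i (lo p) + δ i (hi p)) + sum (δ i)         ≡⟨ ∑-endpoints (δ i) ⟩
  n * sum (δ i)                                         ≡⟨ cong (n *_) (sum-δ i) ⟩
  n * 1                                                 ≡⟨ ℕₚ.*-identityʳ n ⟩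
  n                                                     ∎
  where open ≡-Reasoning

-- The network and its triangle-freeness.

module Network {h : ℕ} (H : SparseGraph h) (a q r : ℕ) where

  open SparseGraph H

  Class : Set
  Class = Fin h

  -- In the class `root` the first q slots provide the ports. The r further slots make every class
  -- so large that deleting a whole class already pays for the entire cut, and they keep each class
  -- alive when the ports are deleted.
  Slot : Set
  Slot = Fin (q + r)

  -- blob i x s is the s-th copy of the vertex x in the i-th blow-up of the base graph.
  data Vertex : Set where
    hub  : Fin a → Vertex
    link : Pair q → Vertex
    blob : Fin q → Class → Slot → Vertex

  slot : Fin q → Slot
  slot j = j ↑ˡ r

  -- The link {i, j} is joined to port i j and port j i; port i i belongs to no link.
  port : Fin q → Fin q → Vertex
  port i j = blob i root (slot j)

  isPort : Fin q → Fin q → Fin q → Class → Slot → Bool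
  isPort i j i′ x s = does (i ≟ i′) ∧ (does (root ≟ x) ∧ does (slot j ≟ s))

  attached : Pair q → Fin q → Class → Slot → Bool
  attached p i x s = isPort (lo p) (hi p) i x s ∨ isPort (hi p) (lo p) i x s

  adj : Vertex → Vertex → Bool
  adj (hub _)      (link _)     = true
  adj (link _)     (hub _)      = true
  adj (link p)     (blob i x s) = attached p i x s
  adj (blob i x s) (link p)     = attached p i x s
  adj (blob i x s) (blob j y u) = does (i ≟ j) ∧ (x ~ᵇ y)
  adj _            _            = false

  instance
    enumVertex : Enumerated Vertex
    enumVertex = transport {Fin a ⊎ (Pair q ⊎ (Fin q × (Class × Slot)))}
      (λ { (inj₁ α) → hub α ; (inj₂ (inj₁ p)) → link p ; (inj₂ (inj₂ (i , x , s))) → blob i x s })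
      (λ { (hub α) → inj₁ α ; (link p) → inj₂ (inj₁ p) ; (blob i x s) → inj₂ (inj₂ (i , x , s)) })
      (λ { (hub α) → refl ; (link p) → refl ; (blob i x s) → refl })
      (λ { (inj₁ α) → refl ; (inj₂ (inj₁ p)) → refl ; (inj₂ (inj₂ (i , x , s))) → refl })

  isPort-true : ∀ {i j i′ x s} → isPort i j i′ x s ≡ true → blob i′ x s ≡ port i j
  isPort-true {i} {j} {i′} {x} {s} eq with ∧-true {does (i ≟ i′)} eq
  ... | eqᵢ , eq′ with ∧-true {does (root ≟ x)} eq′
  ...   | eqₓ , eqₛ with does-true (i ≟ i′) eqᵢ | does-true (root ≟ x) eqₓ | does-true (slot j ≟ s) eqₛ
  ...     | refl | refl | refl = refl

  isPort-refl : ∀ i j → isPort i j i root (slot j) ≡ true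
  isPort-refl i j = cong₂ _∧_ (dec-true (i ≟ i) refl) (cong₂ _∧_ (dec-true (root ≟ root) refl) (dec-true (slot j ≟ slot j) refl))

  attached-true : ∀ {p i x s} → attached p i x s ≡ true →
                  blob i x s ≡ port (lo p) (hi p) ⊎ blob i x s ≡ port (hi p) (lo p)
  attached-true {p} {i} {x} {s} eq with ∨-true {isPort (lo p) (hi p) i x s} eq
  ... | inj₁ eq₁ = inj₁ (isPort-true eq₁)
  ... | inj₂ eq₂ = inj₂ (isPort-true eq₂)

  attached-root : ∀ {p i x s} → attached p i x s ≡ true → x ≡ root
  attached-root {p} {i} {x} {s} eq with attached-true {p} {i} {x} {s} eq
  ... | inj₁ refl = refl
  ... | inj₂ refl = refl

  adj-lo : ∀ p → adj (link p) (port (lo p) (hi p)) ≡ true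
  adj-lo p rewrite isPort-refl (lo p) (hi p) = refl

  adj-hi : ∀ p → adj (link p) (port (hi p) (lo p)) ≡ true
  adj-hi p rewrite isPort-refl (hi p) (lo p) = Boolₚ.∨-zeroʳ _

  adj-blob : ∀ i {x y} s u → x ~ᵇ y ≡ true → adj (blob i x s) (blob i y u) ≡ true
  adj-blob i s u xy = cong₂ _∧_ (dec-true (i ≟ i) refl) xy

  adj-sym : ∀ u v → adj u v ≡ adj v u
  adj-sym (hub _)      (hub _)      = refl
  adj-sym (hub _)      (link _)     = refl
  adj-sym (hub _)      (blob _ _ _) = refl
  adj-sym (link _)     (hub _)      = refl
  adj-sym (link _)     (link _)     = refl
  adj-sym (link _)     (blob _ _ _) = refl
  adj-sym (blob _ _ _) (hub _)      = refl
  adj-sym (blob _ _ _) (link _)     = refl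
  adj-sym (blob i x _) (blob j y _) =
    cong₂ _∧_ (does-⇔ (mk⇔ sym sym) (i ≟ j) (j ≟ i)) (~ᵇ-sym x y)

  adj-irrefl : ∀ v → adj v v ≡ false
  adj-irrefl (hub _)      = refl
  adj-irrefl (link _)     = refl
  adj-irrefl (blob i x _) = trans (cong (does (i ≟ i) ∧_) (~ᵇ-irrefl x)) (Boolₚ.∧-zeroʳ _)

  -- Both ports of a link lie in the class `root`, and vertices of one class are never adjacent.
  link-blob-blob : ∀ {p i x s j y u} → attached p i x s ≡ true → attached p j y u ≡ true →
                   does (i ≟ j) ∧ (x ~ᵇ y) ≡ true → ⊥
  link-blob-blob {p} {i} {x} {s} {j} {y} {u} px py xy
    with attached-root {p} {i} {x} {s} px | attached-root {p} {j} {y} {u} py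
  ... | refl | refl = contradiction (trans (sym (~ᵇ-irrefl root)) (proj₂ (∧-true {does (i ≟ j)} xy))) λ ()

  -- A hub sees only links, and links are pairwise nonadjacent, so no triangle contains a hub. One
  -- with a link has two blob vertices, the case of `link-blob-blob`. One inside a blob projects to
  -- a triangle of the base graph.
  adj-triangle-free : ∀ u v w → adj u v ≡ true → adj v w ≡ true → adj u w ≡ true → ⊥
  adj-triangle-free (hub _)      (link _)     (hub _)      _  _  ()
  adj-triangle-free (hub _)      (link _)     (link _)     _  () _
  adj-triangle-free (hub _)      (link _)     (blob _ _ _) _  _  ()
  adj-triangle-free (link _)     (hub _)      (hub _)      _  () _
  adj-triangle-free (link _)     (hub _)      (link _)     _  _  ()
  adj-triangle-free (link _)     (hub _)      (blob _ _ _) _  () _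
  adj-triangle-free (link _)     (blob _ _ _) (hub _)      _  () _
  adj-triangle-free (link _)     (blob _ _ _) (link _)     _  _  ()
  adj-triangle-free (link p)     (blob i x s) (blob j y u) px xy py = link-blob-blob {p} {i} {x} {s} {j} {y} {u} px py xy
  adj-triangle-free (blob _ _ _) (link _)     (hub _)      _  _  ()
  adj-triangle-free (blob _ _ _) (link _)     (link _)     _  () _
  adj-triangle-free (blob i x s) (link p)     (blob j y u) px py xy = link-blob-blob {p} {i} {x} {s} {j} {y} {u} px py xy
  adj-triangle-free (blob _ _ _) (blob _ _ _) (hub _)      _  () _
  adj-triangle-free (blob i x s) (blob j y u) (link p)     xy py px = link-blob-blob {p} {i} {x} {s} {j} {y} {u} px py xy
  adj-triangle-free (blob i x _) (blob j y _) (blob k z _) xy yz xz =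
    contradiction (trans (sym (triangle-free x y z (proj₂ (∧-true {does (i ≟ j)} xy)) (proj₂ (∧-true {does (j ≟ k)} yz))))
                         (proj₂ (∧-true {does (i ≟ k)} xz))) λ ()

  network : Graph (Fin (size {Vertex}))
  network = record
    { _~_      = λ k l → adj (elem k) (elem l) ≡ true
    ; _~?_     = λ k l → adj (elem k) (elem l) Bool.≟ true
    ; ~-sym    = λ {k} {l} kl → trans (adj-sym (elem l) (elem k)) kl
    ; ~-irrefl = λ {k} kk → contradiction (trans (sym (adj-irrefl (elem k))) kk) λ ()
    }

  network-triangle-free : TriangleFree network
  network-triangle-free u v w (uv , vw , uw) = adj-triangle-free (elem u) (elem v) (elem w) uv vw uw

  ∑-isPort : ∀ i j i′ → ∑ (λ ((x , s) : Class × Slot) → bit (isPort i j i′ x s)) ≡ δ i i′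
  ∑-isPort i j i′ = begin
    sum (λ x → sum (λ s → bit (isPort i j i′ x s)))
      ≡⟨ sum-cong-≗ {h} (λ x → sum-cong-≗ {q + r} (λ s → trans (bit-∧ (does (i ≟ i′)) _)
           (cong (δ i i′ *_) (bit-∧ (does (root ≟ x)) (does (slot j ≟ s)))))) ⟩
    sum (λ x → sum (λ s → δ i i′ * (δ root x * δ (slot j) s)))
      ≡⟨ sum-cong-≗ (λ x → trans (∑-* (δ i i′) (λ s → δ root x * δ (slot j) s))
           (cong (δ i i′ *_) (trans (∑-* (δ root x) (δ (slot j))) (cong (δ root x *_) (sum-δ (slot j)))))) ⟩
    sum {h} (λ x → δ i i′ * (δ root x * 1))
      ≡⟨ ∑-* {Class} (δ i i′) (λ x → δ root x * 1) ⟩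
    δ i i′ * sum {h} (λ x → δ root x * 1)
      ≡⟨ cong (δ i i′ *_) (trans (sum-cong-≗ {h} (λ x → ℕₚ.*-identityʳ (δ root x))) (sum-δ {h} root)) ⟩
    δ i i′ * 1
      ≡⟨ ℕₚ.*-identityʳ (δ i i′) ⟩
    δ i i′ ∎
    where open ≡-Reasoning

  -- The parity argument against a 2-factor.

  module NoTwoFactor
    -- `μ` is the edge indicator of a hypothetical 2-factor; as a numerical function it can be
    -- summed over any block of vertices.
    (μ : Vertex → Vertex → ℕ)
    (μ-sym : ∀ u v → μ u v ≡ μ v u)
    (μ≤adj : ∀ u v → μ u v ≤ bit (adj u v))
    (μ-degree : ∀ v → ∑ (μ v) ≡ 2)
    where

    μ-zero : ∀ {u v} → adj u v ≡ false → μ u v ≡ 0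
    μ-zero {u} {v} eq = ℕₚ.n≤0⇒n≡0 (subst (λ b → μ u v ≤ bit b) eq (μ≤adj u v))

    Blob : Set
    Blob = Class × Slot

    at : Fin q → Blob → Vertex
    at i (x , s) = blob i x s

    leaving : Fin q → ℕ
    leaving i = ∑ (λ b → ∑ (λ p → μ (at i b) (link p)))

    blob-degree : ∀ i b → ∑ (λ p → μ (at i b) (link p)) + ∑ (λ b′ → μ (at i b) (at i b′)) ≡ 2
    blob-degree i b = begin
      ∑ (λ p → μ v (link p)) + ∑ (λ b′ → μ v (at i b′))
        ≡⟨ cong (∑ (λ p → μ v (link p)) +_) (sum-single (λ j → ∑ (λ b′ → μ v (at j b′))) i other-blob) ⟨
      ∑ (λ p → μ v (link p)) + sum (λ j → ∑ (λ b′ → μ v (at j b′)))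
        ≡⟨ cong (_+ (∑ (λ p → μ v (link p)) + sum (λ j → ∑ (λ b′ → μ v (at j b′)))))
             (∑-zero {Fin a} (λ α → μ-zero {v} {hub α} refl)) ⟨
      ∑ (μ v)
        ≡⟨ μ-degree v ⟩
      2 ∎
      where
      open ≡-Reasoning
      v : Vertex
      v = at i b
      other-blob : ∀ j → j ≢ i → ∑ (λ b′ → μ v (at j b′)) ≡ 0
      other-blob j j≢i = ∑-zero {Blob} (λ b′ → μ-zero {v} {at j b′}
        (cong (_∧ (proj₁ b ~ᵇ proj₁ b′)) (dec-false (i ≟ j) (j≢i ∘ sym))))

    -- The degrees inside a blob add up to twice its size, and edges within the blob are counted
    -- twice; what leaves is the difference of two even numbers.
    leaving-even : ∀ i → ∃[ e ] leaving i ≡ e * 2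
    leaving-even i with ∑²-symmetric {Blob} (λ b b′ → μ (at i b) (at i b′))
                          (λ b b′ → μ-sym (at i b) (at i b′)) (λ b → μ-zero (adj-irrefl (at i b)))
    ... | e , inside≡2e = N ℕ.∸ e , (begin
      leaving i                 ≡⟨ ℕₚ.m+n∸n≡m (leaving i) (e * 2) ⟨
      leaving i + e * 2 ℕ.∸ e * 2   ≡⟨ cong (ℕ._∸ e * 2) total ⟩
      N * 2 ℕ.∸ e * 2           ≡⟨ ℕₚ.*-distribʳ-∸ 2 N e ⟨
      (N ℕ.∸ e) * 2             ∎)
      where
      open ≡-Reasoning
      N : ℕ
      N = size {Blob}
      total : leaving i + e * 2 ≡ N * 2
      total = begin
        leaving i + e * 2       ≡⟨ cong (leaving i +_) inside≡2e ⟨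
        leaving i + ∑ {Blob} (λ b → ∑ (λ b′ → μ (at i b) (at i b′)))
                                ≡⟨ ∑-+ {Blob} (λ b → ∑ (λ p → μ (at i b) (link p))) _ ⟨
        ∑ {Blob} (λ b → ∑ (λ p → μ (at i b) (link p)) + ∑ (λ b′ → μ (at i b) (at i b′)))
                                ≡⟨ ∑-cong {Blob} (blob-degree i) ⟩
        ∑ {Blob} (λ _ → 2)      ≡⟨ ∑-const {Blob} 2 ⟩
        N * 2                   ∎

    -- Only the q - 1 links whose pair contains i meet blob i, and each of them does so in a single
    -- vertex.
    leaving<q : ∀ i → suc (leaving i) ≤ q
    leaving<q i = begin
      suc (leaving i)
        ≤⟨ s≤s (∑-mono {Blob} (λ b → ∑-mono (λ p → μ≤adj (at i b) (link p)))) ⟩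
      suc (∑ {Blob} (λ b → ∑ (λ p → bit (adj (at i b) (link p)))))
        ≡⟨ cong suc (∑-swap {Blob} {Pair q} (λ b p → bit (adj (at i b) (link p)))) ⟩
      suc (∑ (λ p → ∑ {Blob} (λ b → bit (adj (at i b) (link p)))))
        ≤⟨ s≤s (∑-mono at-most) ⟩
      suc (∑ (λ p → δ i (lo p) + δ i (hi p)))
        ≡⟨ ∑-endpoints-δ i ⟩
      q ∎
      where
      open ℕₚ.≤-Reasoning
      δ-sym : ∀ {n} (i j : Fin n) → δ i j ≡ δ j i
      δ-sym i j = cong bit (does-⇔ (mk⇔ sym sym) (i ≟ j) (j ≟ i))
      at-most : ∀ p → ∑ {Blob} (λ b → bit (adj (at i b) (link p))) ≤ δ i (lo p) + δ i (hi p)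
      at-most p = begin
        ∑ {Blob} (λ (x , s) → bit (attached p i x s))
          ≤⟨ ∑-mono {Blob} (λ (x , s) → bit-∨≤ (isPort (lo p) (hi p) i x s) _) ⟩
        ∑ {Blob} (λ (x , s) → bit (isPort (lo p) (hi p) i x s) + bit (isPort (hi p) (lo p) i x s))
          ≡⟨ ∑-+ {Blob} (λ (x , s) → bit (isPort (lo p) (hi p) i x s)) _ ⟩
        ∑ {Blob} (λ (x , s) → bit (isPort (lo p) (hi p) i x s)) + ∑ {Blob} (λ (x , s) → bit (isPort (hi p) (lo p) i x s))
          ≡⟨ cong₂ _+_ (∑-isPort (lo p) (hi p) i) (∑-isPort (hi p) (lo p) i) ⟩
        δ (lo p) i + δ (hi p) i
          ≡⟨ cong₂ _+_ (δ-sym (lo p) i) (δ-sym (hi p) i) ⟩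
        δ i (lo p) + δ i (hi p) ∎

    -- The one place where the parity of q matters: leaving i is even and less than q.
    leaving+2≤q : ∀ {m} → q ≡ m * 2 → ∀ i → leaving i + 2 ≤ q
    leaving+2≤q {m} q≡2m i with leaving-even i
    ... | e , eq = begin
      leaving i + 2    ≡⟨ cong (_+ 2) eq ⟩
      e * 2 + 2        ≡⟨ ℕₚ.+-comm (e * 2) 2 ⟩
      suc e * 2        ≤⟨ ℕₚ.*-monoˡ-≤ 2 (ℕₚ.*-cancelʳ-< 2 e m (subst₂ _≤_ (cong suc eq) q≡2m (leaving<q i))) ⟩
      m * 2            ≡⟨ q≡2m ⟨
      q                ∎
      where open ℕₚ.≤-Reasoning

    hub-degree : ∀ α → ∑ (λ p → μ (link p) (hub α)) ≡ 2
    hub-degree α = begin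
      ∑ (λ p → μ (link p) (hub α))    ≡⟨ ∑-cong (λ p → μ-sym (link p) (hub α)) ⟩
      ∑ (λ p → μ (hub α) (link p))    ≡⟨ ℕₚ.+-identityʳ _ ⟨
      ∑ (λ p → μ (hub α) (link p)) + 0
        ≡⟨ cong₂ (λ x y → x + (∑ (λ p → μ (hub α) (link p)) + y))
             (∑-zero {Fin a} (λ β → μ-zero {hub α} {hub β} refl))
             (∑-zero {Fin q × Blob} (λ (i , b) → μ-zero {hub α} {at i b} refl)) ⟨
      ∑ (μ (hub α))                   ≡⟨ μ-degree (hub α) ⟩
      2                               ∎
      where open ≡-Reasoning

    link-degree : ∀ p → sum (λ α → μ (link p) (hub α)) + ∑ (λ ((i , b) : Fin q × Blob) → μ (link p) (at i b)) ≡ 2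
    link-degree p = begin
      hubs + blobs        ≡⟨ cong (λ x → hubs + (x + blobs)) (∑-zero {Pair q} (λ p′ → μ-zero {link p} {link p′} refl)) ⟨
      ∑ (μ (link p))      ≡⟨ μ-degree (link p) ⟩
      2                   ∎
      where
      open ≡-Reasoning
      hubs blobs : ℕ
      hubs = sum (λ α → μ (link p) (hub α))
      blobs = ∑ (λ ((i , b) : Fin q × Blob) → μ (link p) (at i b))

    -- Double counting of the edge ends at links: every link has degree 2, every hub spends its
    -- degree 2 on links, and all other edges at links come out of blobs.
    link-degrees : 2 * ∑ (λ (_ : Pair q) → 1) ≡ a * 2 + sum leaving
    link-degrees = begin
      2 * ∑ (λ (_ : Pair q) → 1)
        ≡⟨ ∑-* 2 (λ (_ : Pair q) → 1) ⟨
      ∑ (λ (_ : Pair q) → 2)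
        ≡⟨ ∑-cong link-degree ⟨
      ∑ (λ p → sum (λ α → μ (link p) (hub α)) + ∑ {Fin q × Blob} (λ (i , b) → μ (link p) (at i b)))
        ≡⟨ ∑-+ (λ p → sum (λ α → μ (link p) (hub α))) _ ⟩
      ∑ (λ p → sum (λ α → μ (link p) (hub α))) + ∑ (λ p → ∑ {Fin q × Blob} (λ (i , b) → μ (link p) (at i b)))
        ≡⟨ cong₂ _+_ (∑-swap {Pair q} {Fin a} (λ p α → μ (link p) (hub α)))
                     (∑-swap {Pair q} {Fin q × Blob} (λ p (i , b) → μ (link p) (at i b))) ⟩
      sum (λ α → ∑ (λ p → μ (link p) (hub α))) + ∑ {Fin q × Blob} (λ (i , b) → ∑ (λ p → μ (link p) (at i b)))
        ≡⟨ cong₂ _+_ (trans (sum-cong-≗ hub-degree) (sum-const a 2))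
                     (∑-cong {Fin q × Blob} (λ (i , b) → ∑-cong (λ p → μ-sym (link p) (at i b)))) ⟩
      a * 2 + sum leaving ∎
      where open ≡-Reasoning

    impossible : ∀ {m} → q ≡ m * 2 → suc (a * 2) ≤ q → ⊥
    impossible {m} q≡2m 2a<q = ℕₚ.<-irrefl refl (begin-strict
      q * q                                    ≡⟨ pair-count q ⟨
      2 * ∑ (λ (_ : Pair q) → 1) + q           ≡⟨ cong (_+ q) link-degrees ⟩
      -- Replacing 2a by q makes the inequality strict; the two summands q then supply the `+ 2` for
      -- each of the q blobs.
      a * 2 + sum leaving + q                  <⟨ ℕₚ.+-monoˡ-< q (ℕₚ.+-monoˡ-< (sum leaving) 2a<q) ⟩
      q + sum leaving + q                      ≡⟨ shuffle q (sum leaving) ⟩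
      sum leaving + q * 2                      ≡⟨ cong (sum leaving +_) (sum-const q 2) ⟨
      sum leaving + sum {q} (λ _ → 2)          ≡⟨ ∑-distrib-+ leaving (λ _ → 2) ⟨
      sum (λ i → leaving i + 2)                ≤⟨ sum-mono (leaving+2≤q {m} q≡2m) ⟩
      sum {q} (λ _ → q)                        ≡⟨ sum-const q q ⟩
      q * q                                    ∎)
      where
      open ℕₚ.≤-Reasoning
      shuffle : ∀ q s → q + s + q ≡ s + q * 2
      shuffle = solve-∀

  no-two-factor : ∀ {m} → q ≡ m * 2 → suc (a * 2) ≤ q → ¬ HasTwoFactor network
  no-two-factor {m} q≡2m 2a<q (F , F⊆G , 2-regular) = NoTwoFactor.impossible μ μ-sym μ≤adj μ-degree {m} q≡2m 2a<q
    where
    open Graph F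
    μ : Vertex → Vertex → ℕ
    μ u v = bit (does (index u ~? index v))
    μ-sym : ∀ u v → μ u v ≡ μ v u
    μ-sym u v = cong bit (does-≡ (index u) (index v))
      where
      does-≡ : ∀ k l → does (k ~? l) ≡ does (l ~? k)
      does-≡ k l with k ~? l | l ~? k
      ... | yes _  | yes _  = refl
      ... | yes kl | no ¬lk = contradiction (~-sym kl) ¬lk
      ... | no ¬kl | yes lk = contradiction (~-sym lk) ¬kl
      ... | no _   | no _   = refl
    μ≤adj : ∀ u v → μ u v ≤ bit (adj u v)
    μ≤adj u v = bit-mono (λ eq → subst₂ (λ u v → adj u v ≡ true) (elem-index u) (elem-index v)
      (F⊆G (does-true (index u ~? index v) eq)))
    μ-degree : ∀ v → ∑ (μ v) ≡ 2
    μ-degree v = begin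
      ∑ (μ v)                                                ≡⟨ ∑-elem (μ v) ⟩
      sum (λ k → bit (does (index v ~? index (elem {Vertex} k))))     ≡⟨ sum-cong-≗ (λ k → cong (λ l → bit (does (index v ~? l))) (index-elem {Vertex} k)) ⟩
      sum (λ k → bit (does (index v ~? k)))                  ≡⟨ count-tabulate (index v ~?_) id ⟨
      degree F (index v)                                     ≡⟨ 2-regular (index v) ⟩
      2                                                      ∎
      where open ≡-Reasoning

-- Lower bounds on the size of a cut.

not-false : ∀ {b} → not b ≡ true → b ≡ false
not-false {false} _ = refl

not-true : ∀ {b} → not b ≡ false → b ≡ true
not-true {true} _ = refl

bit-true : ∀ {b} → b ≡ true → 1 ≤ bit b
bit-true refl = s≤s z≤n

term≤sum : ∀ {n} (f : Fin n → ℕ) i → f i ≤ sum f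
term≤sum f zero    = ℕₚ.m≤m+n _ _
term≤sum f (suc i) = ℕₚ.≤-trans (term≤sum (f ∘ suc) i) (ℕₚ.m≤n+m _ (f zero))

module NetworkCuts {h : ℕ} (H : SparseGraph h) (a q r : ℕ) where
  open Network H a q r
  open SparseGraph H

  -- A walk to `root` in the base graph lifts to the chosen survivors of the classes along it. The
  -- relation is abstract because it serves twice: as equality of labels in an arbitrary cut, and as
  -- existence of walks in the extremal one.
  blob-connected : ∀ {E : Set} (_≈_ : E → E → Set) → IsEquivalence _≈_ → (vertex : E → Vertex) →
    (∀ {e f} → adj (vertex e) (vertex f) ≡ true → e ≈ f) →
    ∀ i → (∀ x → ∃[ e ] ∃[ s ] vertex e ≡ blob i x s) →
    ∀ {e f x y s u} → vertex e ≡ blob i x s → vertex f ≡ blob i y u → e ≈ f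
  blob-connected {E} _≈_ equiv vertex adj⇒≈ i survivor e-at f-at =
    E.trans (to-root e-at) (E.sym (to-root f-at))
    where
    module E = IsEquivalence equiv
    at-blobs : ∀ {e f x y s u} → vertex e ≡ blob i x s → vertex f ≡ blob i y u → x ~ᵇ y ≡ true → e ≈ f
    at-blobs {s = s} {u} e-at f-at xy =
      adj⇒≈ (trans (cong₂ adj e-at f-at) (adj-blob i s u xy))
    seat : Class → E
    seat x = proj₁ (survivor x)
    seat-at : ∀ x → vertex (seat x) ≡ blob i x (proj₁ (proj₂ (survivor x)))
    seat-at x = proj₂ (proj₂ (survivor x))
    walk : ∀ {x y} → Star (Adjacent _~ᵇ_) x y → seat x ≈ seat y
    walk ε = E.refl
    walk (xy ◅ path) = E.trans (at-blobs (seat-at _) (seat-at _) xy) (walk path)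
    to-root : ∀ {e x s} → vertex e ≡ blob i x s → e ≈ seat root
    to-root {x = x} e-at with neighbour x
    -- The detour through a neighbouring class is essential: a vertex is not adjacent to the chosen
    -- survivor of its own class.
    ... | y , xy = E.trans (at-blobs e-at (seat-at y) xy) (walk (connected y))

  b : ℕ
  b = ∑ (λ (_ : Pair q) → 1)

  -- Sufficient conditions for the toughness to be at least T / P; D / P is the
  -- deficit 2 − T / P.
  record Bounds (P T D : ℕ) : Set where
    field
      2P≡T+D      : 2 * P ≡ T + D
      D≤P         : D ≤ P
      1≤q         : 1 ≤ q
      r-large     : 18 * (a + b + q * h) ≤ r
      few-links   : T * (a + q) ≤ P * b
      high-degree : 3 * T + P ≤ P * q
      separation  : ∀ k x → 1 ≤ k → k ≤ q → 2 * q * k + k ≤ 2 * x + k * k + 2 * q → T * k ≤ D * x + P * a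

  -- `dead` is the deleted set and `label` names the component of a survivor. Constancy along edges
  -- limits how many labels occur, and surjectivity turns this into an upper bound on c.
  module Cut {c : ℕ} (dead : Vertex → Bool)
    (label : ∀ v → dead v ≡ false → Fin c)
    (label-adj : ∀ {u v} (u↑ : dead u ≡ false) (v↑ : dead v ≡ false) → adj u v ≡ true → label u u↑ ≡ label v v↑)
    (label-onto : ∀ γ → ∃[ v ] Σ[ v↑ ∈ dead v ≡ false ] label v v↑ ≡ γ)
    where

    _∈ᶜ_ : Vertex → Fin c → Set
    v ∈ᶜ γ = Σ[ v↑ ∈ dead v ≡ false ] label v v↑ ≡ γ

    ∈ᶜ-functional : ∀ {v γ γ′} → v ∈ᶜ γ → v ∈ᶜ γ′ → γ ≡ γ′
    ∈ᶜ-functional {v} (v↑ , eq) (v↑′ , eq′) =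
      trans (sym eq) (trans (cong (label v) (≡-irrelevant v↑ v↑′)) eq′)

    ∈ᶜ-adj : ∀ {u v γ γ′} → u ∈ᶜ γ → v ∈ᶜ γ′ → adj u v ≡ true → γ ≡ γ′
    ∈ᶜ-adj (u↑ , eq) (v↑ , eq′) uv = trans (sym eq) (trans (label-adj u↑ v↑ uv) eq′)

    ∈ᶜ-alive : ∀ {v} (v↑ : dead v ≡ false) → v ∈ᶜ label v v↑
    ∈ᶜ-alive v↑ = v↑ , refl

    cutSize hubCost : ℕ
    cutSize = ∑ (bit ∘ dead)
    hubCost = sum (λ α → bit (dead (hub α)))

    blobCost : Fin q → ℕ
    blobCost i = sum (λ x → sum (λ s → bit (dead (blob i x s))))

    t : ℕ
    t = q + r

    present : Fin q → Class → Bool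
    present i x = exists (λ s → not (dead (blob i x s)))

    present-alive : ∀ {i x} → present i x ≡ true → ∃[ s ] dead (blob i x s) ≡ false
    present-alive {i} {x} eq with exists-true (λ s → not (dead (blob i x s))) eq
    ... | s , alive = s , not-false alive

    alive-present : ∀ {i x s} → dead (blob i x s) ≡ false → present i x ≡ true
    alive-present {i} {x} {s} alive with present i x in eq
    ... | true  = refl
    ... | false = contradiction (trans (sym (cong not alive)) (exists-false (λ s → not (dead (blob i x s))) eq s)) λ ()

    absent-cost : ∀ i x → t * bit (not (present i x)) ≤ sum (λ s → bit (dead (blob i x s)))
    absent-cost i x with present i x in eq
    ... | true  = ℕₚ.≤-trans (ℕₚ.≤-reflexive (ℕₚ.*-zeroʳ t)) z≤n
    ... | false = ℕₚ.≤-reflexive (trans (sym (sum-const t 1)) (sum-cong-≗ {t} (λ s →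
                    sym (cong bit (not-true (exists-false (λ s → not (dead (blob i x s))) eq s))))))

    absent-costs : ∀ i → t * sum (λ x → bit (not (present i x))) ≤ blobCost i
    absent-costs i = ℕₚ.≤-trans (ℕₚ.≤-reflexive (sym (∑-* {Class} t (λ x → bit (not (present i x))))))
      (sum-mono {h} (absent-cost i))

    -- A class that keeps a surviving neighbour class lies in one component; the other
    -- surviving classes contribute at most t components each.
    components≤ : 9 * c ≤ 9 * (a + b + q * h) + 4 * cutSize
    components≤ = begin
      9 * c
        ≤⟨ ℕₚ.*-monoʳ-≤ 9 (cover {L} w _∼_ (λ {l} → functional {l}) hit) ⟩
      9 * ∑ w
        ≡⟨ cong (λ s → 9 * ((s + (b + blobs)) + classes)) (sum-ones a) ⟩
      9 * ((a + (b + blobs)) + classes)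
        ≡⟨ cong (λ s → 9 * ((a + (b + blobs)) + s)) (trans (sum-const q _) (cong (q *_) (sum-ones h))) ⟩
      9 * ((a + (b + blobs)) + q * h)
        ≡⟨ regroup a b blobs (q * h) ⟩
      9 * (a + b + q * h) + 9 * blobs
        ≤⟨ ℕₚ.+-monoʳ-≤ (9 * (a + b + q * h)) blobs≤ ⟩
      9 * (a + b + q * h) + 4 * sum blobCost
        ≤⟨ ℕₚ.+-monoʳ-≤ (9 * (a + b + q * h)) (ℕₚ.*-monoʳ-≤ 4
             (ℕₚ.≤-trans (ℕₚ.m≤n+m (sum blobCost) _) (ℕₚ.m≤n+m _ hubCost))) ⟩
      9 * (a + b + q * h) + 4 * cutSize ∎
      where
      open ℕₚ.≤-Reasoning
      L : Set
      L = Vertex ⊎ (Fin q × Class)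
      w : L → ℕ
      w (inj₁ (hub _))      = 1
      w (inj₁ (link _))     = 1
      w (inj₁ (blob i x _)) = bit (isolated _~ᵇ_ (present i) x)
      w (inj₂ _)            = 1
      _∼_ : L → Fin c → Set
      inj₁ v       ∼ γ = v ∈ᶜ γ
      inj₂ (i , x) ∼ γ = (∃[ s ] blob i x s ∈ᶜ γ) × (∃[ y ] x ~ᵇ y ≡ true × present i y ≡ true)
      functional : ∀ {l γ γ′} → l ∼ γ → l ∼ γ′ → γ ≡ γ′
      functional {inj₁ v} v∈γ v∈γ′ = ∈ᶜ-functional v∈γ v∈γ′
      functional {inj₂ (i , x)} ((s , s∈γ) , y , xy , y-present) ((s′ , s′∈γ′) , _) with present-alive {i} {y} y-present
      -- Both copies of class x are adjacent to the survivor `u` of class y.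
      ... | u , u↑ = trans (∈ᶜ-adj s∈γ (∈ᶜ-alive u↑) (adj-blob i s u xy))
                           (sym (∈ᶜ-adj s′∈γ′ (∈ᶜ-alive u↑) (adj-blob i s′ u xy)))
      hit : ∀ γ → ∃[ l ] 1 ≤ w l × l ∼ γ
      hit γ with label-onto γ
      ... | v@(hub _)  , v∈γ = inj₁ v , s≤s z≤n , v∈γ
      ... | v@(link _) , v∈γ = inj₁ v , s≤s z≤n , v∈γ
      ... | v@(blob i x s) , v∈γ with exists (λ y → (x ~ᵇ y) ∧ present i y) in eq
      ...   | false = inj₁ v , bit-true (cong₂ _∧_ (alive-present (proj₁ v∈γ)) (cong not eq)) , v∈γ
      ...   | true with exists-true (λ y → (x ~ᵇ y) ∧ present i y) eq
      ...     | y , both = inj₂ (i , x) , s≤s z≤n , (s , v∈γ) , y , ∧-true both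
      blobs classes : ℕ
      blobs   = sum (λ i → sum (λ x → sum {t} (λ s → bit (isolated _~ᵇ_ (present i) x))))
      classes = sum {q} (λ _ → sum {h} (λ _ → 1))
      regroup : ∀ a b c d → 9 * ((a + (b + c)) + d) ≡ 9 * (a + b + d) + 9 * c
      regroup = solve-∀
      swap-* : ∀ k t s → k * (t * s) ≡ t * (k * s)
      swap-* = solve-∀
      blobs≤ : 9 * blobs ≤ 4 * sum blobCost
      blobs≤ = begin
        9 * blobs
          ≡⟨ cong (9 *_) (sum-cong-≗ (λ i → trans (sum-cong-≗ {h} (λ x → sum-const t (bit (isolated _~ᵇ_ (present i) x)))) (∑-* {Class} t (λ x → bit (isolated _~ᵇ_ (present i) x))))) ⟩
        9 * sum (λ i → t * sum (λ x → bit (isolated _~ᵇ_ (present i) x)))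
          ≡⟨ ∑-* {Fin q} 9 _ ⟨
        sum (λ i → 9 * (t * sum (λ x → bit (isolated _~ᵇ_ (present i) x))))
          ≤⟨ sum-mono (λ i → begin
               9 * (t * sum (λ x → bit (isolated _~ᵇ_ (present i) x)))     ≡⟨ swap-* 9 t _ ⟩
               -- Expansion is applied to the set of surviving classes: those isolated in it are at
               -- most 4/9 as many as the absent ones, each of which costs t deletions.
               t * (9 * sum (λ x → bit (isolated _~ᵇ_ (present i) x)))     ≤⟨ ℕₚ.*-monoʳ-≤ t (sparse (present i)) ⟩
               t * (4 * sum (λ x → bit (not (present i x))))          ≡⟨ swap-* 4 t _ ⟨
               4 * (t * sum (λ x → bit (not (present i x))))          ≤⟨ ℕₚ.*-monoʳ-≤ 4 (absent-costs i) ⟩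
               4 * blobCost i                                         ∎) ⟩
        sum (λ i → 4 * blobCost i)
          ≡⟨ ∑-* {Fin q} 4 blobCost ⟩
        4 * sum blobCost ∎

    portCost linkCost : Pair q → ℕ
    portCost p = bit (dead (port (lo p) (hi p))) + bit (dead (port (hi p) (lo p)))
    linkCost p = bit (dead (link p))

    -- The ports of links are the off-diagonal entries of the array `port i j`, whose i-th row
    -- consists of distinct vertices of blob i.
    ports≤blobs : ∑ portCost ≤ sum blobCost
    ports≤blobs = begin
      ∑ portCost                                                      ≤⟨ ℕₚ.m≤m+n _ _ ⟩
      ∑ portCost + sum (λ i → bit (dead (port i i)))                  ≡⟨ sum²-pairs (λ i j → bit (dead (port i j))) ⟨
      sum (λ i → sum (λ j → bit (dead (port i j))))                   ≤⟨ sum-mono {q} (λ i → begin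
        sum (λ j → bit (dead (port i j)))                               ≤⟨ ℕₚ.m≤m+n _ _ ⟩
        _ + sum (λ s → bit (dead (blob i root (q ↑ʳ s))))               ≡⟨ sum-↑ q (λ s → bit (dead (blob i root s))) ⟨
        sum (λ s → bit (dead (blob i root s)))                          ≤⟨ term≤sum (λ x → sum (λ s → bit (dead (blob i x s)))) root ⟩
        blobCost i                                                      ∎) ⟩
      sum blobCost                                                    ∎
      where open ℕₚ.≤-Reasoning

    cost≤cutSize : hubCost + ∑ (λ p → linkCost p + portCost p) ≤ cutSize
    cost≤cutSize = ℕₚ.+-monoʳ-≤ hubCost (ℕₚ.≤-trans (ℕₚ.≤-reflexive (∑-+ linkCost portCost))
      (ℕₚ.+-monoʳ-≤ (∑ linkCost) ports≤blobs))

    -- If every class keeps a survivor, each blob i lies in a single component, `κ i`.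
    module Intact (survivor : ∀ i x → ∃[ s ] dead (blob i x s) ≡ false) where

      κ : Fin q → Fin c
      κ i = label (blob i root _) (proj₂ (survivor i root))

      κ-blob : ∀ {i x s γ} → blob i x s ∈ᶜ γ → κ i ≡ γ
      κ-blob {i} {x} {s} (alive , eq) = trans
        (blob-connected {Σ[ v ∈ Vertex ] dead v ≡ false} (λ (u , u↑) (v , v↑) → label u u↑ ≡ label v v↑)
          (record { refl = refl ; sym = sym ; trans = trans }) proj₁ (λ {(u , u↑)} {(v , v↑)} → label-adj u↑ v↑) i
          (λ x → (blob i x _ , proj₂ (survivor i x)) , _ , refl)
          {blob i root _ , proj₂ (survivor i root)} {blob i x s , alive} refl refl)
        eq

      lo-link : ∀ {p γ} → link p ∈ᶜ γ → dead (port (lo p) (hi p)) ≡ false → κ (lo p) ≡ γ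
      lo-link {p} link∈γ port↑ = trans (κ-blob (∈ᶜ-alive port↑))
        (sym (∈ᶜ-adj link∈γ (∈ᶜ-alive port↑) (adj-lo p)))

      hi-link : ∀ {p γ} → link p ∈ᶜ γ → dead (port (hi p) (lo p)) ≡ false → κ (hi p) ≡ γ
      hi-link {p} link∈γ port↑ = trans (κ-blob (∈ᶜ-alive port↑))
        (sym (∈ᶜ-adj link∈γ (∈ᶜ-alive port↑) (adj-hi p)))

      no-links : (∀ p → dead (link p) ≡ true) → c ≤ a + q × b ≤ cutSize
      no-links links↓ = c≤ , b≤
        where
        open ℕₚ.≤-Reasoning
        _∼_ : Fin a ⊎ Fin q → Fin c → Set
        inj₁ α ∼ γ = hub α ∈ᶜ γ
        inj₂ i ∼ γ = κ i ≡ γ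
        functional : ∀ {l γ γ′} → l ∼ γ → l ∼ γ′ → γ ≡ γ′
        functional {inj₁ α} = ∈ᶜ-functional
        functional {inj₂ i} eq eq′ = trans (sym eq) eq′
        hit : ∀ γ → ∃[ l ] 1 ≤ 1 × l ∼ γ
        hit γ with label-onto γ
        ... | hub α      , v∈γ = inj₁ α , s≤s z≤n , v∈γ
        ... | link p     , v↑ , _ = contradiction (trans (sym v↑) (links↓ p)) λ ()
        ... | blob i x s , v∈γ = inj₂ i , s≤s z≤n , κ-blob v∈γ
        c≤ : c ≤ a + q
        c≤ = begin
          c                                       ≤⟨ cover (λ _ → 1) _∼_ (λ {l} → functional {l}) hit ⟩
          sum {a} (λ _ → 1) + sum {q} (λ _ → 1)   ≡⟨ cong₂ _+_ (sum-ones a) (sum-ones q) ⟩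
          a + q                                   ∎
        b≤ : b ≤ cutSize
        b≤ = begin
          b                                              ≡⟨ ∑-cong (λ p → sym (cong bit (links↓ p))) ⟩
          ∑ linkCost                                     ≤⟨ ∑-mono (λ p → ℕₚ.m≤m+n (linkCost p) (portCost p)) ⟩
          ∑ (λ p → linkCost p + portCost p)              ≤⟨ ℕₚ.m≤n+m _ hubCost ⟩
          hubCost + ∑ (λ p → linkCost p + portCost p)    ≤⟨ cost≤cutSize ⟩
          cutSize                                        ∎

      -- All surviving hubs and links share one component `γ₀`. If z blobs lie outside it, then c ≤
      -- 1 + z, and every pair with such a blob as an end pays for a deletion. As a pair has two
      -- ends, (q - 1) z ≤ 2 `cutSize`; a single such blob gives q - 1 ≤ `cutSize`. Adding these
      -- yields (q - 1)(1 + z) ≤ 3 `cutSize`.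
      some-hub-and-link : ∀ {α p} → dead (hub α) ≡ false → dead (link p) ≡ false →
                          2 ≤ c → q * c ≤ 3 * cutSize + c
      some-hub-and-link {α₀} {p₀} hub↑ link↑ 2≤c = ℕₚ.+-cancelʳ-≤ _ _ _ (begin
        -- `gap` is the slack in c ≤ 1 + z; it passes the bound from 1 + z down to c without
        -- subtraction.
        q * c + q * gap                           ≡⟨ ℕₚ.*-distribˡ-+ q c gap ⟨
        q * (c + gap)                             ≡⟨ cong (q *_) c+gap ⟩
        q * (1 + z)                               ≡⟨ trans (ℕₚ.*-distribˡ-+ q 1 z) (cong (_+ q * z) (ℕₚ.*-identityʳ q)) ⟩
        q + q * z                                 ≤⟨ ℕₚ.+-mono-≤ q≤ qz≤ ⟩
        suc cutSize + (2 * cutSize + z)           ≡⟨ regroup cutSize z ⟩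
        3 * cutSize + (1 + z)                     ≡⟨ cong (3 * cutSize +_) c+gap ⟨
        3 * cutSize + (c + gap)                   ≡⟨ ℕₚ.+-assoc (3 * cutSize) c gap ⟨
        3 * cutSize + c + gap                     ≤⟨ ℕₚ.+-monoʳ-≤ (3 * cutSize + c) gap≤ ⟩
        3 * cutSize + c + q * gap                 ∎)
        where
        open ℕₚ.≤-Reasoning
        γ₀ : Fin c
        γ₀ = label (hub α₀) hub↑
        hub-γ₀ : ∀ {α γ} → hub α ∈ᶜ γ → γ ≡ γ₀
        hub-γ₀ v∈γ = trans (∈ᶜ-adj v∈γ (∈ᶜ-alive link↑) refl) (sym (label-adj hub↑ link↑ refl))
        link-γ₀ : ∀ {p γ} → link p ∈ᶜ γ → γ ≡ γ₀
        link-γ₀ v∈γ = ∈ᶜ-adj v∈γ (∈ᶜ-alive hub↑) refl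
        away : Fin q → ℕ
        away i = κ i ≢ᵇ γ₀
        z : ℕ
        z = sum away
        _∼_ : Fin 1 ⊎ Fin q → Fin c → Set
        inj₁ _ ∼ γ = γ ≡ γ₀
        inj₂ i ∼ γ = κ i ≡ γ
        functional : ∀ {l γ γ′} → l ∼ γ → l ∼ γ′ → γ ≡ γ′
        functional {inj₁ _} eq eq′ = trans eq (sym eq′)
        functional {inj₂ i} eq eq′ = trans (sym eq) eq′
        w : Fin 1 ⊎ Fin q → ℕ
        w = [ (λ _ → 1) , away ]′
        hit : ∀ γ → ∃[ l ] 1 ≤ w l × l ∼ γ
        hit γ with γ ≟ γ₀ | label-onto γ
        ... | yes γ≡γ₀ | _ = inj₁ zero , s≤s z≤n , γ≡γ₀
        ... | no γ≢γ₀ | hub _ , v∈γ = contradiction (hub-γ₀ v∈γ) γ≢γ₀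
        ... | no γ≢γ₀ | link _ , v∈γ = contradiction (link-γ₀ v∈γ) γ≢γ₀
        ... | no γ≢γ₀ | blob i _ _ , v∈γ = inj₂ i ,
          ℕₚ.≤-reflexive (sym (≢ᵇ-≢ (λ κi≡γ₀ → γ≢γ₀ (trans (sym (κ-blob v∈γ)) κi≡γ₀)))) , κ-blob v∈γ
        c≤ : c ≤ 1 + z
        c≤ = cover w _∼_ (λ {l} → functional {l}) hit
        gap : ℕ
        gap = 1 + z ℕ.∸ c
        c+gap : c + gap ≡ 1 + z
        c+gap = ℕₚ.m+[n∸m]≡n c≤
        -- A surviving link is in `γ₀`, so a surviving port would draw its blob into `γ₀` as well.
        away-lo : ∀ p → κ (lo p) ≢ γ₀ → 1 ≤ linkCost p + portCost p
        away-lo p κ≢ with dead (link p) in eq | dead (port (lo p) (hi p)) in eq′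
        ... | true  | _    = s≤s z≤n
        ... | false | true = s≤s z≤n
        ... | false | false = contradiction (trans (lo-link (∈ᶜ-alive eq) eq′) (link-γ₀ (∈ᶜ-alive eq))) κ≢
        away-hi : ∀ p → κ (hi p) ≢ γ₀ → 1 ≤ linkCost p + portCost p
        away-hi p κ≢ with dead (link p) in eq | dead (port (hi p) (lo p)) in eq′
        ... | true  | _    = s≤s z≤n
        ... | false | true = ℕₚ.m≤n+m 1 (bit (dead (port (lo p) (hi p))))
        ... | false | false = contradiction (trans (hi-link (∈ᶜ-alive eq) eq′) (link-γ₀ (∈ᶜ-alive eq))) κ≢
        costs≤ : ∑ (λ p → linkCost p + portCost p) ≤ cutSize
        costs≤ = ℕₚ.≤-trans (ℕₚ.m≤n+m _ hubCost) cost≤cutSize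
        qz≤ : q * z ≤ 2 * cutSize + z
        qz≤ = begin
          q * z                                              ≡⟨ ∑-endpoints away ⟨
          ∑ (λ p → away (lo p) + away (hi p)) + z            ≤⟨ ℕₚ.+-monoˡ-≤ z (∑-mono both) ⟩
          ∑ (λ p → 2 * (linkCost p + portCost p)) + z        ≡⟨ cong (_+ z) (∑-* 2 (λ p → linkCost p + portCost p)) ⟩
          2 * ∑ (λ p → linkCost p + portCost p) + z          ≤⟨ ℕₚ.+-monoˡ-≤ z (ℕₚ.*-monoʳ-≤ 2 costs≤) ⟩
          2 * cutSize + z                                    ∎
          where
          both : ∀ p → away (lo p) + away (hi p) ≤ 2 * (linkCost p + portCost p)
          both p = ℕₚ.+-mono-≤ lo≤ (ℕₚ.≤-trans hi≤ (ℕₚ.m≤m+n _ 0))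
            where
            lo≤ : away (lo p) ≤ linkCost p + portCost p
            lo≤ with κ (lo p) ≟ γ₀
            ... | yes _ = z≤n
            ... | no κ≢ = away-lo p κ≢
            hi≤ : away (hi p) ≤ linkCost p + portCost p
            hi≤ with κ (hi p) ≟ γ₀
            ... | yes _ = z≤n
            ... | no κ≢ = away-hi p κ≢
        q≤ : q ≤ suc cutSize
        q≤ with Finₚ.any? (λ i → ¬? (κ i ≟ γ₀))
        ... | no all-γ₀ = contradiction (ℕₚ.≤-trans 2≤c (ℕₚ.≤-trans c≤ (ℕₚ.≤-reflexive (cong suc
              (∑-zero {Fin q} (λ i → away-zero i (λ κ≢ → all-γ₀ (i , κ≢)))))))) λ { (s≤s ()) }
          where
          away-zero : ∀ i → ¬ ¬ κ i ≡ γ₀ → away i ≡ 0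
          away-zero i ¬¬eq with κ i ≟ γ₀
          ... | yes _ = refl
          ... | no κ≢ = contradiction κ≢ ¬¬eq
        ... | yes (i₀ , κ≢) = begin
          q                                                  ≡⟨ ∑-endpoints-δ i₀ ⟨
          suc (∑ (λ p → δ i₀ (lo p) + δ i₀ (hi p)))          ≤⟨ s≤s (∑-mono incident) ⟩
          suc (∑ (λ p → linkCost p + portCost p))            ≤⟨ s≤s costs≤ ⟩
          suc cutSize                                        ∎
          where
          incident : ∀ p → δ i₀ (lo p) + δ i₀ (hi p) ≤ linkCost p + portCost p
          incident p with i₀ ≟ lo p | i₀ ≟ hi p
          ... | yes eq   | yes eq′ = contradiction (trans (sym eq) eq′) (lo≢hi p)
          ... | yes refl | no _    = away-lo p κ≢
          ... | no _     | yes refl = away-hi p κ≢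
          ... | no _     | no _    = z≤n
        gap≤ : gap ≤ q * gap
        gap≤ = ℕₚ.≤-trans (ℕₚ.≤-reflexive (sym (ℕₚ.*-identityˡ gap))) (ℕₚ.*-monoˡ-≤ gap 1≤q)
          where
          1≤q : 1 ≤ q
          1≤q = ℕₚ.≤-trans (s≤s z≤n) (Finₚ.toℕ<n (lo p₀))
        regroup : ∀ s z → suc s + (2 * s + z) ≡ 3 * s + (1 + z)
        regroup = solve-∀

      -- Once all hubs are deleted, these links are components of their own.
      lone : Pair q → Bool
      lone p = not (dead (link p)) ∧ (dead (port (lo p) (hi p)) ∧ dead (port (hi p) (lo p)))

      separated : ℕ
      separated = ∑ (λ p → κ (lo p) ≢ᵇ κ (hi p))

      module NoHubs (hubs↓ : ∀ α → dead (hub α) ≡ true) where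

        -- A surviving link with a surviving port belongs to the component of a blob, and any other
        -- surviving link is lone. `fresh` indices count each component of blobs once.
        c≤ : c ≤ distinct κ + ∑ (bit ∘ lone)
        c≤ = cover w _∼_ (λ {l} → functional {l}) hit
          where
          _∼_ : Fin q ⊎ Pair q → Fin c → Set
          inj₁ i ∼ γ = κ i ≡ γ
          inj₂ p ∼ γ = link p ∈ᶜ γ
          functional : ∀ {l γ γ′} → l ∼ γ → l ∼ γ′ → γ ≡ γ′
          functional {inj₁ i} eq eq′ = trans (sym eq) eq′
          functional {inj₂ p} = ∈ᶜ-functional
          w : Fin q ⊎ Pair q → ℕ
          w = [ bit ∘ fresh κ , bit ∘ lone ]′
          fresh-first : ∀ {i γ} → κ i ≡ γ → ∃[ l ] 1 ≤ w l × l ∼ γ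
          fresh-first {i} κi≡γ with fresh-hit κ i
          ... | j , j-fresh , κj≡κi = inj₁ j , bit-true j-fresh , trans κj≡κi κi≡γ
          hit : ∀ γ → ∃[ l ] 1 ≤ w l × l ∼ γ
          hit γ with label-onto γ
          ... | hub α      , v↑ , _ = contradiction (trans (sym v↑) (hubs↓ α)) λ ()
          ... | blob i x s , v∈γ = fresh-first (κ-blob v∈γ)
          ... | link p     , v∈γ with dead (port (lo p) (hi p)) in eq | dead (port (hi p) (lo p)) in eq′
          ...   | false | _     = fresh-first (lo-link v∈γ eq)
          ...   | true  | false = fresh-first (hi-link v∈γ eq′)
          ...   | true  | true  = inj₂ p , bit-true (cong₂ _∧_ (cong not (proj₁ v∈γ)) (cong₂ _∧_ eq eq′)) , v∈γ

        lone-cost : ∀ p → lone p ≡ true → 2 ≤ linkCost p + portCost p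
        lone-cost p eq with ∧-true {not (dead (link p))} eq
        ... | _ , ports↓ with ∧-true {dead (port (lo p) (hi p))} ports↓
        ...   | eq₁ , eq₂ rewrite eq₁ | eq₂ = ℕₚ.m≤n+m 2 (linkCost p)

        separated-cost : ∀ p → κ (lo p) ≢ κ (hi p) → 1 ≤ linkCost p + portCost p
        separated-cost p κ≢ with dead (link p) in eq | dead (port (lo p) (hi p)) in eq₁ | dead (port (hi p) (lo p)) in eq₂
        ... | true  | _     | _     = s≤s z≤n
        ... | false | true  | _     = s≤s z≤n
        ... | false | false | true  = s≤s z≤n
        ... | false | false | false =
          contradiction (trans (lo-link (∈ᶜ-alive eq) eq₁) (sym (hi-link (∈ᶜ-alive eq) eq₂))) κ≢

        -- A lone link has lost both ports, and P · 2 = T + D pays for it together with a possible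
        -- separation. Otherwise a separated pair has lost its link or a port, and one P covers D.
        charge : ∀ {P T D} → 2 * P ≡ T + D → D ≤ P → ∀ p →
                 T * bit (lone p) + D * (κ (lo p) ≢ᵇ κ (hi p)) ≤ P * (linkCost p + portCost p)
        charge {P} {T} {D} 2P≡T+D D≤P p with lone p in eq
        ... | true  = begin
          T * 1 + D * bit (not (does (κ (lo p) ≟ κ (hi p))))
                      ≤⟨ ℕₚ.+-monoʳ-≤ (T * 1) (ℕₚ.*-monoʳ-≤ D (bit≤1 (not (does (κ (lo p) ≟ κ (hi p)))))) ⟩
          T * 1 + D * 1                    ≡⟨ ℕₚ.*-distribʳ-+ 1 T D ⟨
          (T + D) * 1                      ≡⟨ cong (_* 1) 2P≡T+D ⟨
          2 * P * 1                        ≡⟨ ℕₚ.*-identityʳ (2 * P) ⟩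
          2 * P                            ≡⟨ ℕₚ.*-comm 2 P ⟩
          P * 2                            ≤⟨ ℕₚ.*-monoʳ-≤ P (lone-cost p eq) ⟩
          P * (linkCost p + portCost p)    ∎
          where open ℕₚ.≤-Reasoning
        ... | false = begin
          T * 0 + D * (κ (lo p) ≢ᵇ κ (hi p))
                      ≡⟨ cong (_+ D * (κ (lo p) ≢ᵇ κ (hi p))) (ℕₚ.*-zeroʳ T) ⟩
          D * (κ (lo p) ≢ᵇ κ (hi p))       ≤⟨ ℕₚ.*-mono-≤ D≤P differ≤ ⟩
          P * (linkCost p + portCost p)    ∎
          where
          open ℕₚ.≤-Reasoning
          differ≤ : κ (lo p) ≢ᵇ κ (hi p) ≤ linkCost p + portCost p
          differ≤ with κ (lo p) ≟ κ (hi p)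
          ... | yes _ = z≤n
          ... | no κ≢ = separated-cost p κ≢

        -- The charges are summed over all pairs, and the a deleted hubs are added. What remains to
        -- show is T k ≤ D x + P a for k groups of blobs and x separated pairs, which is the field
        -- `separation`.
        no-hubs : ∀ {P T D} → 2 * P ≡ T + D → D ≤ P →
                  T * c + D * separated + P * a ≤ T * distinct κ + P * cutSize
        no-hubs {P} {T} {D} 2P≡T+D D≤P = begin
          T * c + D * separated + P * a
            ≤⟨ ℕₚ.+-monoˡ-≤ (P * a) (ℕₚ.+-monoˡ-≤ (D * separated) (ℕₚ.*-monoʳ-≤ T c≤)) ⟩
          T * (distinct κ + lones) + D * separated + P * a
            ≡⟨ regroup P T D (distinct κ) lones separated a ⟩
          T * distinct κ + (P * a + (T * lones + D * separated))
            ≤⟨ ℕₚ.+-monoʳ-≤ (T * distinct κ) (ℕₚ.+-mono-≤ (ℕₚ.≤-reflexive (cong (P *_) (sym hubs-cost))) charges) ⟩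
          T * distinct κ + (P * hubCost + P * costs)
            ≡⟨ cong (T * distinct κ +_) (ℕₚ.*-distribˡ-+ P hubCost costs) ⟨
          T * distinct κ + P * (hubCost + costs)
            ≤⟨ ℕₚ.+-monoʳ-≤ (T * distinct κ) (ℕₚ.*-monoʳ-≤ P cost≤cutSize) ⟩
          T * distinct κ + P * cutSize ∎
          where
          open ℕₚ.≤-Reasoning
          lones costs : ℕ
          lones = ∑ (bit ∘ lone)
          costs = ∑ (λ p → linkCost p + portCost p)
          hubs-cost : hubCost ≡ a
          hubs-cost = trans (sum-cong-≗ (cong bit ∘ hubs↓)) (sum-ones a)
          charges : T * lones + D * separated ≤ P * costs
          charges = begin
            T * lones + D * separated
              ≡⟨ cong₂ _+_ (∑-* T (bit ∘ lone)) (∑-* D (λ p → κ (lo p) ≢ᵇ κ (hi p))) ⟨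
            ∑ (λ p → T * bit (lone p)) + ∑ (λ p → D * (κ (lo p) ≢ᵇ κ (hi p)))
              ≡⟨ ∑-+ (λ p → T * bit (lone p)) _ ⟨
            ∑ (λ p → T * bit (lone p) + D * (κ (lo p) ≢ᵇ κ (hi p)))
              ≤⟨ ∑-mono (charge 2P≡T+D D≤P) ⟩
            ∑ (λ p → P * (linkCost p + portCost p))
              ≡⟨ ∑-* P (λ p → linkCost p + portCost p) ⟩
            P * costs ∎
          regroup : ∀ P T D k l x a → T * (k + l) + D * x + P * a ≡ T * k + (P * a + (T * l + D * x))
          regroup = solve-∀

    class-lost : ∀ {i x} → (∀ s → dead (blob i x s) ≡ true) → t ≤ cutSize
    class-lost {i} {x} lost = begin
      t                                              ≡⟨ sum-ones t ⟨
      sum {t} (λ _ → 1)                              ≡⟨ sum-cong-≗ (cong bit ∘ lost) ⟨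
      sum (λ s → bit (dead (blob i x s)))            ≤⟨ term≤sum (λ x → sum (λ s → bit (dead (blob i x s)))) x ⟩
      blobCost i                                     ≤⟨ term≤sum blobCost i ⟩
      sum blobCost                                   ≤⟨ ℕₚ.m≤n+m (sum blobCost) _ ⟩
      _                                              ≤⟨ ℕₚ.m≤n+m _ hubCost ⟩
      cutSize                                        ∎
      where
      open ℕₚ.≤-Reasoning

    -- With R = a + b + q h and s = `cutSize`, doubling `components≤` gives 18 c ≤ 18 R + 8 s, and
    -- the lost class alone gives 18 R ≤ s. The expansion factor 9/4 > 2 is what leaves this last s
    -- free.
    class-lost⇒2c≤ : 18 * (a + b + q * h) ≤ r → ∀ {i x} → (∀ s → dead (blob i x s) ≡ true) → 2 * c ≤ cutSize
    class-lost⇒2c≤ r-large lost = ℕₚ.*-cancelˡ-≤ 9 (begin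
      9 * (2 * c)                                      ≡⟨ swap-* 9 2 c ⟩
      2 * (9 * c)                                      ≤⟨ ℕₚ.*-monoʳ-≤ 2 components≤ ⟩
      2 * (9 * R + 4 * cutSize)                        ≡⟨ regroup R cutSize ⟩
      18 * R + 8 * cutSize                             ≤⟨ ℕₚ.+-monoˡ-≤ (8 * cutSize) (ℕₚ.≤-trans r-large
                                                            (ℕₚ.≤-trans (ℕₚ.m≤n+m r q) (class-lost lost))) ⟩
      cutSize + 8 * cutSize                            ≡⟨⟩
      9 * cutSize                                      ∎)
      where
      open ℕₚ.≤-Reasoning
      R : ℕ
      R = a + b + q * h
      swap-* : ∀ k l c → k * (l * c) ≡ l * (k * c)
      swap-* = solve-∀
      regroup : ∀ R s → 2 * (9 * R + 4 * s) ≡ 18 * R + 8 * s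
      regroup = solve-∀

    module _ {P T D : ℕ} (bounds : Bounds P T D) where
      open Bounds bounds

      toughness-bound : 2 ≤ c → T * c ≤ P * cutSize
      toughness-bound 2≤c with Finₚ.any? (λ i → Finₚ.any? (λ x → Finₚ.all? (λ s → dead (blob i x s) Bool.≟ true)))
      ... | yes (i , x , lost) = begin
        T * c               ≤⟨ ℕₚ.*-monoˡ-≤ c (ℕₚ.≤-trans (ℕₚ.m≤m+n T D) (ℕₚ.≤-reflexive (sym 2P≡T+D))) ⟩
        2 * P * c           ≡⟨ regroup P c ⟩
        P * (2 * c)         ≤⟨ ℕₚ.*-monoʳ-≤ P (class-lost⇒2c≤ r-large lost) ⟩
        P * cutSize         ∎
        where
        open ℕₚ.≤-Reasoning
        regroup : ∀ P c → 2 * P * c ≡ P * (2 * c)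
        regroup = solve-∀
      ... | no none-lost = intact
        where
        open ℕₚ.≤-Reasoning
        survivor : ∀ i x → ∃[ s ] dead (blob i x s) ≡ false
        survivor i x with Finₚ.any? (λ s → dead (blob i x s) Bool.≟ false)
        ... | yes found = found
        ... | no none = contradiction (i , x , λ s → Boolₚ.¬-not (λ eq → none (s , eq))) none-lost
        open Intact survivor
        intact : T * c ≤ P * cutSize
        intact with Finₚ.any? (λ α → dead (hub α) Bool.≟ false) | Finₚ.any? (λ k → dead (link (elem {Pair q} k)) Bool.≟ false)
        -- `separation`, at the actual number of groups and of separated pairs, cancels the extra
        -- terms of `no-hubs`.
        ... | no none | _ = ℕₚ.+-cancelʳ-≤ _ _ _ (begin
          T * c + (D * separated + P * a)             ≡⟨ ℕₚ.+-assoc (T * c) _ _ ⟨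
          T * c + D * separated + P * a               ≤⟨ NoHubs.no-hubs (λ α → Boolₚ.¬-not (λ eq → none (α , eq))) 2P≡T+D D≤P ⟩
          T * distinct κ + P * cutSize        ≡⟨ ℕₚ.+-comm (T * distinct κ) _ ⟩
          P * cutSize + T * distinct κ        ≤⟨ ℕₚ.+-monoʳ-≤ (P * cutSize)
            (separation (distinct κ) separated (distinct≥1 κ 1≤q) (distinct≤n κ) (separated-pairs κ)) ⟩
          P * cutSize + (D * separated + P * a)       ∎)
        -- `high-degree` says 3T ≤ P (q - 1), to be combined with (q - 1) c ≤ 3 `cutSize`.
        ... | yes (α , hub↑) | yes (k , link↑) = ℕₚ.*-cancelˡ-≤ 3 (ℕₚ.+-cancelʳ-≤ _ _ _ (begin
          3 * (T * c) + P * c                 ≡⟨ regroup₁ T P c ⟩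
          (3 * T + P) * c                     ≤⟨ ℕₚ.*-monoˡ-≤ c high-degree ⟩
          P * q * c                           ≡⟨ ℕₚ.*-assoc P q c ⟩
          P * (q * c)                         ≤⟨ ℕₚ.*-monoʳ-≤ P (some-hub-and-link hub↑ link↑ 2≤c) ⟩
          P * (3 * cutSize + c)               ≡⟨ regroup₂ P cutSize c ⟩
          3 * (P * cutSize) + P * c           ∎))
          where
          regroup₁ : ∀ T P c → 3 * (T * c) + P * c ≡ (3 * T + P) * c
          regroup₁ = solve-∀
          regroup₂ : ∀ P s c → P * (3 * s + c) ≡ 3 * (P * s) + P * c
          regroup₂ = solve-∀
        ... | yes _ | no none with no-links (λ p → Boolₚ.¬-not (λ eq → none (index p , subst (λ p → dead (link p) ≡ false) (sym (elem-index p)) eq)))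
        ...   | c≤ , b≤ = begin
          T * c                               ≤⟨ ℕₚ.*-monoʳ-≤ T c≤ ⟩
          T * (a + q)                         ≤⟨ few-links ⟩
          P * b                               ≤⟨ ℕₚ.*-monoʳ-≤ P b≤ ⟩
          P * cutSize                         ∎

-- From subsets to cuts, and the extremal cut.

∣∣-sum : ∀ {n} (S : Subset n) → ∣ S ∣ ≡ sum (λ k → bit (lookup S k))
∣∣-sum []          = refl
∣∣-sum (true  ∷ S) = cong suc (∣∣-sum S)
∣∣-sum (false ∷ S) = ∣∣-sum S

outside⇒∈∁ : ∀ {n} (S : Subset n) {k} → lookup S k ≡ false → k ∈ ∁ S
outside⇒∈∁ S {k} eq = Vecₚ.lookup⇒[]= k (∁ S) (trans (Vecₚ.lookup-map k not S) (cong not eq))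

∈∁⇒outside : ∀ {n} (S : Subset n) {k} → k ∈ ∁ S → lookup S k ≡ false
∈∁⇒outside S {k} k∈ = not-false (trans (sym (Vecₚ.lookup-map k not S)) (Vecₚ.[]=⇒lookup k∈))

remaining-≡ : ∀ {n} {S : Subset n} {k l} {k∈ : k ∈ ∁ S} {l∈ : l ∈ ∁ S} →
              k ≡ l → _≡_ {A = Σ[ k ∈ Fin n ] k ∈ ∁ S} (k , k∈) (l , l∈)
remaining-≡ {k = k} refl = cong (k ,_) (Vecₚ.[]=-irrelevant _ _)

module NetworkToughness {h : ℕ} (H : SparseGraph h) (a q r : ℕ) where
  open Network H a q r
  open NetworkCuts H a q r
  open SparseGraph H

  N : ℕ
  N = size {Vertex}

  cut-bound : ∀ {P T D} → Bounds P T D → (S : Subset N) (c : ℕ) →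
              HasComponents (network ∖ S) c → 2 ≤ c → T * c ≤ P * ∣ S ∣
  cut-bound {P} {T} bounds S c components 2≤c =
    subst (λ s → T * c ≤ P * s) cutSize≡∣S∣
      (Cut.toughness-bound dead label (λ {u} {v} → label-adj {u} {v}) label-onto bounds 2≤c)
    where
    open Bijection components using (to; surjective) renaming (cong to to-cong)
    dead : Vertex → Bool
    dead v = lookup S (index v)
    label : ∀ v → dead v ≡ false → Fin c
    label v v↑ = to (index v , outside⇒∈∁ S v↑)
    label-adj : ∀ {u v} (u↑ : dead u ≡ false) (v↑ : dead v ≡ false) →
                adj u v ≡ true → label u u↑ ≡ label v v↑
    label-adj {u} {v} _ _ uv =
      to-cong (trans (cong₂ adj (elem-index u) (elem-index v)) uv ◅ ε)
    label-onto : ∀ γ → ∃[ v ] Σ[ v↑ ∈ dead v ≡ false ] label v v↑ ≡ γ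
    label-onto γ with surjective γ
    ... | (k , k∈) , to≡γ = elem k ,
      trans (cong (lookup S) (index-elem {Vertex} k)) (∈∁⇒outside S k∈) ,
      trans (cong to (remaining-≡ (index-elem {Vertex} k))) (to≡γ ε)
    cutSize≡∣S∣ : ∑ (bit ∘ dead) ≡ ∣ S ∣
    cutSize≡∣S∣ = begin
      ∑ (bit ∘ dead)                                       ≡⟨ ∑-elem (bit ∘ dead) ⟩
      sum (λ k → bit (lookup S (index (elem {Vertex} k)))) ≡⟨ sum-cong-≗ (λ k → cong (bit ∘ lookup S) (index-elem {Vertex} k)) ⟩
      sum (λ k → bit (lookup S k))                         ≡⟨ ∣∣-sum S ⟨
      ∣ S ∣                                                ∎
      where open ≡-Reasoning

  -- Slot i of blob i belongs to no link, hence the exclusion of j = i: each blob loses q - 1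
  -- vertices.
  portSlot : Fin q → Slot → Bool
  portSlot i s = [ (λ j → not (does (i ≟ j))) , (λ _ → false) ]′ (splitAt q s)

  critical : Vertex → Bool
  critical (hub _)      = true
  critical (link _)     = false
  critical (blob i x s) = does (root ≟ x) ∧ portSlot i s

  criticalSet : Subset N
  criticalSet = tabulate (critical ∘ elem)

  ∑-critical : ∑ (bit ∘ critical) + q ≡ a + q * q
  ∑-critical = begin
    sum {a} (λ _ → 1) + (∑ {Pair q} (λ _ → 0) + sum blobCritical) + q
      ≡⟨ cong₂ (λ x y → x + (y + sum blobCritical) + q) (sum-ones a) (∑-zero {Pair q} (λ _ → refl)) ⟩
    a + sum blobCritical + q
      ≡⟨ ℕₚ.+-assoc a _ q ⟩
    a + (sum blobCritical + q)
      ≡⟨ cong (λ x → a + (sum blobCritical + x)) (sum-ones q) ⟨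
    a + (sum blobCritical + sum {q} (λ _ → 1))
      ≡⟨ cong (a +_) (∑-distrib-+ blobCritical (λ _ → 1)) ⟨
    a + sum (λ i → blobCritical i + 1)
      ≡⟨ cong (a +_) (trans (sum-cong-≗ perBlob) (sum-const q q)) ⟩
    a + q * q ∎
    where
    open ≡-Reasoning
    blobCritical : Fin q → ℕ
    blobCritical i = sum (λ x → sum (λ s → bit (does (root ≟ x) ∧ portSlot i s)))
    slots : ∀ i → sum (λ s → bit (portSlot i s)) + 1 ≡ q
    slots i = begin
      sum (λ s → bit (portSlot i s)) + 1
        ≡⟨ cong (_+ 1) (sum-↑ q (λ s → bit (portSlot i s))) ⟩
      sum (λ j → bit (portSlot i (j ↑ˡ r))) + sum (λ j → bit (portSlot i (q ↑ʳ j))) + 1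
        ≡⟨ cong₂ (λ x y → x + y + 1)
             (sum-cong-≗ (λ j → cong (bit ∘ [ (λ j → not (does (i ≟ j))) , (λ _ → false) ]′) (Finₚ.splitAt-↑ˡ q j r)))
             (∑-zero {Fin r} (λ j → cong (bit ∘ [ (λ j → not (does (i ≟ j))) , (λ _ → false) ]′) (Finₚ.splitAt-↑ʳ q r j))) ⟩
      others + 0 + 1
        ≡⟨ cong₂ _+_ (ℕₚ.+-identityʳ others) (sym (sum-δ i)) ⟩
      others + sum (δ i)
        ≡⟨ ∑-distrib-+ (λ j → bit (not (does (i ≟ j)))) (δ i) ⟨
      sum (λ j → bit (not (does (i ≟ j))) + δ i j)
        ≡⟨ sum-cong-≗ (λ j → trans (ℕₚ.+-comm (bit (not (does (i ≟ j)))) (δ i j)) (bit-split (does (i ≟ j)))) ⟩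
      sum {q} (λ _ → 1)
        ≡⟨ sum-ones q ⟩
      q ∎
      where
      others : ℕ
      others = sum (λ j → bit (not (does (i ≟ j))))
    perBlob : ∀ i → blobCritical i + 1 ≡ q
    perBlob i = trans (cong (_+ 1) (begin
      blobCritical i
        ≡⟨ sum-cong-≗ {h} (λ x → trans (sum-cong-≗ {q + r} (λ s → bit-∧ (does (root ≟ x)) (portSlot i s)))
             (∑-* (δ root x) (λ s → bit (portSlot i s)))) ⟩
      sum (λ x → δ root x * inner)
        ≡⟨ sum-single (λ x → δ root x * inner) root (λ x x≢root → cong (_* inner) (δ-≢ (x≢root ∘ sym))) ⟩
      δ root root * inner
        ≡⟨ trans (cong (_* inner) (δ-refl root)) (ℕₚ.*-identityˡ inner) ⟩
      inner ∎)) (slots i)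
      where
      inner : ℕ
      inner = sum (λ s → bit (portSlot i s))

  ∣criticalSet∣ : ∣ criticalSet ∣ + q ≡ a + q * q
  ∣criticalSet∣ = trans (cong (_+ q) (begin
    ∣ criticalSet ∣                            ≡⟨ ∣∣-sum criticalSet ⟩
    sum (λ k → bit (lookup criticalSet k))     ≡⟨ sum-cong-≗ (λ k → cong bit (Vecₚ.lookup∘tabulate (critical ∘ elem) k)) ⟩
    sum (λ k → bit (critical (elem k)))        ≡⟨ ∑-elem (bit ∘ critical) ⟨
    ∑ (bit ∘ critical)                         ∎)) ∑-critical
    where open ≡-Reasoning

  port-critical : ∀ {i j} → i ≢ j → critical (port i j) ≡ true
  port-critical {i} {j} i≢j
    rewrite dec-true (root ≟ root) refl | Finₚ.splitAt-↑ˡ q j r | dec-false (i ≟ j) i≢j = refl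

  attached-critical : ∀ p i x s → attached p i x s ≡ true → critical (blob i x s) ≡ true
  attached-critical p i x s eq with attached-true {p} {i} {x} {s} eq
  ... | inj₁ refl = port-critical (lo≢hi p)
  ... | inj₂ refl = port-critical (lo≢hi p ∘ sym)

  -- Without hubs and ports every link is isolated. Every blob stays connected, because the spare
  -- slot keeps a survivor in each class.
  criticalSet-components : Fin r → HasComponents (network ∖ criticalSet) (size {Pair q ⊎ Fin q})
  criticalSet-components spare = record
    { to        = to
    ; cong      = fold (λ e f → to e ≡ to f) (λ {e} {f} ef → trans (to-adj {e} {f} ef)) refl
    ; bijective = (λ {e} {f} → to-injective {e} {f}) , to-surjective
    }
    where
    Rest : Set
    Rest = Σ[ k ∈ Fin N ] k ∈ ∁ criticalSet
    vertex : Rest → Vertex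
    vertex (k , _) = elem k
    spared : (e : Rest) → critical (vertex e) ≡ false
    spared (k , k∈) = trans (sym (Vecₚ.lookup∘tabulate (critical ∘ elem) k)) (∈∁⇒outside criticalSet k∈)
    place : ∀ v → critical v ≡ false → Rest
    place v v↑ = index v , outside⇒∈∁ criticalSet
      (trans (Vecₚ.lookup∘tabulate (critical ∘ elem) (index v)) (trans (cong critical (elem-index v)) v↑))
    component : ∀ v → critical v ≡ false → Pair q ⊎ Fin q
    component (link p)     _ = inj₁ p
    component (blob i _ _) _ = inj₂ i
    component-adj : ∀ u v u↑ v↑ → adj u v ≡ true → component u u↑ ≡ component v v↑
    component-adj (link p)     (blob i x s) u↑ v↑ uv = contradiction (trans (sym (attached-critical p i x s uv)) v↑) λ ()
    component-adj (blob i x s) (link p)     u↑ v↑ uv = contradiction (trans (sym (attached-critical p i x s uv)) u↑) λ ()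
    component-adj (blob i x _) (blob j y _) u↑ v↑ uv = cong inj₂ (does-true (i ≟ j) (proj₁ (∧-true {does (i ≟ j)} uv)))
    component-irrelevant : ∀ {u v} u↑ v↑ → u ≡ v → component u u↑ ≡ component v v↑
    component-irrelevant {link _}     _ _ refl = refl
    component-irrelevant {blob _ _ _} _ _ refl = refl
    to : Rest → Fin (size {Pair q ⊎ Fin q})
    to e = index (component (vertex e) (spared e))
    to-adj : ∀ {e f} → Adj (network ∖ criticalSet) e f → to e ≡ to f
    to-adj {e} {f} ef = cong index (component-adj (vertex e) (vertex f) (spared e) (spared f) ef)
    _≈_ : Rest → Rest → Set
    _≈_ = Star (Adj (network ∖ criticalSet))
    core : ∀ i x → critical (blob i x (q ↑ʳ spare)) ≡ false
    core i x rewrite Finₚ.splitAt-↑ʳ q r spare = Boolₚ.∧-zeroʳ _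
    same-component : ∀ u v u↑ v↑ → component u u↑ ≡ component v v↑ → ∀ e f → vertex e ≡ u → vertex f ≡ v → e ≈ f
    -- A link is alone in its component, so both ends are the same vertex and the empty walk
    -- suffices.
    same-component (link p) (link p) u↑ v↑ refl (k , _) (l , _) e-at f-at =
      subst ((k , _) ≈_) (remaining-≡ (trans (sym (index-elem {Vertex} k)) (trans (cong index (trans e-at (sym f-at))) (index-elem {Vertex} l)))) ε
    same-component (blob i x s) (blob i y u) u↑ v↑ refl e f e-at f-at =
      blob-connected _≈_ (Setoid.isEquivalence (componentSetoid (network ∖ criticalSet))) vertex (λ ef → ef ◅ ε) i
        (λ x → place (blob i x (q ↑ʳ spare)) (core i x) , _ , elem-index _) e-at f-at
    to-injective : ∀ {e f} → to e ≡ to f → e ≈ f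
    to-injective {e} {f} eq = same-component _ _ (spared e) (spared f)
      (trans (sym (elem-index _)) (trans (cong elem eq) (elem-index _))) e f refl refl
    to-place : ∀ v v↑ → to (place v v↑) ≡ index (component v v↑)
    to-place v v↑ = cong index (component-irrelevant _ v↑ (elem-index v))
    representative : (l : Pair q ⊎ Fin q) → Σ[ e ∈ Rest ] to e ≡ index l
    representative (inj₁ p) = place (link p) refl , to-place (link p) refl
    representative (inj₂ i) = place (blob i root (q ↑ʳ spare)) (core i root) , to-place (blob i root (q ↑ʳ spare)) (core i root)
    to-surjective : ∀ γ → Σ[ e ∈ Rest ] (∀ {f} → f ≈ e → to f ≡ γ)
    to-surjective γ with representative (elem γ)
    ... | e , to-e = e , λ {f} f≈e →
      trans (fold (λ e f → to e ≡ to f) (λ {e} {f} ef → trans (to-adj {e} {f} ef)) refl f≈e)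
            (trans to-e (index-elem {Pair q ⊎ Fin q} γ))

-- Fractions and the definition of toughness.

toℚᵘ-/ : ∀ i n .{{_ : NonZero n}} → ℚ.toℚᵘ (i / n) ℚᵘ.≃ (i ℚᵘ./ n)
toℚᵘ-/ i (suc n) = ℚₚ.toℚᵘ-fromℚᵘ (mkℚᵘ i n)

toℚᵘ-/-* : ∀ x y k .{{_ : NonZero y}} →
           ℚ.toℚᵘ (ℤ.+ x / y ℚ.* (ℤ.+ k / 1)) ℚᵘ.≃ (ℤ.+ x ℚᵘ./ y) ℚᵘ.* (ℤ.+ k ℚᵘ./ 1)
toℚᵘ-/-* x y k = ℚᵘₚ.≃-trans (ℚₚ.toℚᵘ-homo-* (ℤ.+ x / y) (ℤ.+ k / 1))
  (ℚᵘₚ.*-cong (toℚᵘ-/ (ℤ.+ x) y) (toℚᵘ-/ (ℤ.+ k) 1))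

pos-** : ∀ x k l → ℤ.+ (x * k * l) ≡ ℤ.+ x ℤ.* ℤ.+ k ℤ.* ℤ.+ l
pos-** x k l = trans (ℤₚ.pos-* (x * k) l) (cong (ℤ._* ℤ.+ l) (ℤₚ.pos-* x k))

-- Unnormalised rationals keep x and y unreduced, so the comparison is literally one of cross
-- products.
/-*≤ : ∀ {x y k s} .{{_ : NonZero y}} → x * k ≤ y * s → ℤ.+ x / y ℚ.* (ℤ.+ k / 1) ℚ.≤ ℤ.+ s / 1
/-*≤ {x} {suc y} {k} {s} xk≤ys = ℚₚ.toℚᵘ-cancel-≤ (begin
  ℚ.toℚᵘ (ℤ.+ x / suc y ℚ.* (ℤ.+ k / 1))    ≃⟨ toℚᵘ-/-* x (suc y) k ⟩
  mkℚᵘ (ℤ.+ x) y ℚᵘ.* mkℚᵘ (ℤ.+ k) 0        ≤⟨ *≤* (subst₂ ℤ._≤_ (pos-** x k 1) (ℤₚ.pos-* s (suc y * 1))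
                                                 (ℤ.+≤+ (subst₂ _≤_ (sym (ℕₚ.*-identityʳ (x * k))) (ys y s) xk≤ys))) ⟩
  mkℚᵘ (ℤ.+ s) 0                            ≃⟨ toℚᵘ-/ (ℤ.+ s) 1 ⟨
  ℚ.toℚᵘ (ℤ.+ s / 1)                        ∎)
  where
  open ℚᵘₚ.≤-Reasoning
  ys : ∀ y s → suc y * s ≡ s * (suc y * 1)
  ys = solve-∀

≤/-* : ∀ {x y k s} .{{_ : NonZero y}} → y * s ≤ x * k → ℤ.+ s / 1 ℚ.≤ ℤ.+ x / y ℚ.* (ℤ.+ k / 1)
≤/-* {x} {suc y} {k} {s} ys≤xk = ℚₚ.toℚᵘ-cancel-≤ (begin
  ℚ.toℚᵘ (ℤ.+ s / 1)                        ≃⟨ toℚᵘ-/ (ℤ.+ s) 1 ⟩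
  mkℚᵘ (ℤ.+ s) 0                            ≤⟨ *≤* (subst₂ ℤ._≤_ (ℤₚ.pos-* s (suc y * 1)) (pos-** x k 1)
                                                 (ℤ.+≤+ (subst₂ _≤_ (ys y s) (sym (ℕₚ.*-identityʳ (x * k))) ys≤xk))) ⟩
  mkℚᵘ (ℤ.+ x) y ℚᵘ.* mkℚᵘ (ℤ.+ k) 0        ≃⟨ toℚᵘ-/-* x (suc y) k ⟨
  ℚ.toℚᵘ (ℤ.+ x / suc y ℚ.* (ℤ.+ k / 1))    ∎)
  where
  open ℚᵘₚ.≤-Reasoning
  ys : ∀ y s → suc y * s ≡ s * (suc y * 1)
  ys = solve-∀

/-minus : ∀ {i j k} y .{{_ : NonZero y}} → i ≡ k ℤ.* ℤ.+ y ℤ.- j → i / y ≡ k / 1 ℚ.- j / y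
/-minus {i} {j} {k} y@(suc y-1) i≡ = ℚₚ.toℚᵘ-injective (begin
  ℚ.toℚᵘ (i / y)                          ≈⟨ toℚᵘ-/ i y ⟩
  mkℚᵘ i y-1                              ≈⟨ *≡* (trans (cong (ℤ._* (ℤ.+ (1 * y))) i≡) (trans
                                               (cong (λ z → (k ℤ.* ℤ.+ y ℤ.- j) ℤ.* z) (cong ℤ.+_ (ℕₚ.*-identityˡ y)))
                                               (distribute k (ℤ.+ y) j))) ⟩
  mkℚᵘ k 0 ℚᵘ.+ (ℚᵘ.- mkℚᵘ j y-1)         ≈⟨ ℚᵘₚ.+-cong (toℚᵘ-/ k 1) (ℚᵘₚ.-‿cong (toℚᵘ-/ j y)) ⟨
  ℚ.toℚᵘ (k / 1) ℚᵘ.+ ℚᵘ.- ℚ.toℚᵘ (j / y) ≈⟨ ℚᵘₚ.+-congʳ (ℚ.toℚᵘ (k / 1)) (ℚₚ.toℚᵘ-homo‿- (j / y)) ⟨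
  ℚ.toℚᵘ (k / 1) ℚᵘ.+ ℚ.toℚᵘ (ℚ.- (j / y)) ≈⟨ ℚₚ.toℚᵘ-homo-+ (k / 1) (ℚ.- (j / y)) ⟨
  ℚ.toℚᵘ (k / 1 ℚ.- j / y)                ∎)
  where
  open import Relation.Binary.Reasoning.Setoid ℚᵘₚ.≃-setoid
  distribute : ∀ k y j → (k ℤ.* y ℤ.- j) ℤ.* y ≡ (k ℤ.* y ℤ.+ ℤ.- j ℤ.* ℤ.+ 1) ℤ.* y
  distribute = ℤ-Solver.solve-∀

-- If G is t-tough, the tight set gives t c₀ ≤ ∣S₀∣ ≤ (x / y) c₀, and the positive c₀ cancels.
isToughness : ∀ {n} (G : Graph (Fin n)) {x y} .{{_ : NonZero y}} →
  (∀ S c → HasComponents (G ∖ S) c → 2 ≤ c → x * c ≤ y * ∣ S ∣) →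
  ∀ S₀ {c₀} → HasComponents (G ∖ S₀) c₀ → 2 ≤ c₀ → y * ∣ S₀ ∣ ≤ x * c₀ →
  IsToughness G [ ℤ.+ x / y ]
isToughness G {x} {y} bound S₀ {c₀@(suc _)} components 2≤c₀ tight =
  ≤/-*-0 , (λ S c comps 2≤c → /-*≤ {x} {y} (bound S c comps 2≤c)) , maximal
  where
  ≤/-*-0 : 0ℚ ℚ.≤ ℤ.+ x / y
  ≤/-*-0 = ℚₚ.nonNegative⁻¹ (ℤ.+ x / y) {{ℚₚ.normalize-nonNeg x y}}
  maximal : ∀ t → 0ℚ ℚ.≤ t → Tough t G → t ℚ.≤ ℤ.+ x / y
  maximal t _ tough = ℚₚ.*-cancelʳ-≤-pos (ℤ.+ c₀ / 1) {{ℚₚ.normalize-pos c₀ 1}}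
    (ℚₚ.≤-trans (tough S₀ c₀ components 2≤c₀) (≤/-* {x} {y} tight))

-- Numerical parameters for q = 2 (n + 3).

≤-by : ∀ {x y} z → x + z ≡ y → x ≤ y
≤-by z refl = ℕₚ.m≤m+n _ z

-- a = q / 2 − 1, b = q (q − 1) / 2, P = q (q + 1) / 2 and D = (3q + 2) / 2.
module Parameters (n : ℕ) where
  q a b P T D r : ℕ
  q = (3 + n) * 2
  a = 2 + n
  b = 15 + 11 * n + 2 * (n * n)
  P = 21 + 13 * n + 2 * (n * n)
  T = 32 + 23 * n + 4 * (n * n)
  D = 10 + 3 * n
  -- 13 is the order of the circulant graph; `suc` ensures that a spare slot exists.
  r = suc (18 * (a + b + q * 13))

  links : ∑ (λ (_ : Pair q) → 1) ≡ b
  links = ℕₚ.*-cancelˡ-≡ _ _ 2 (ℕₚ.+-cancelʳ-≡ q _ _ (trans (pair-count q) (eq n)))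
    where
    eq : ∀ n → (3 + n) * 2 * ((3 + n) * 2) ≡ 2 * (15 + 11 * n + 2 * (n * n)) + (3 + n) * 2
    eq = solve-∀

  2P≡T+D : 2 * P ≡ T + D
  2P≡T+D = eq n
    where
    eq : ∀ n → 2 * (21 + 13 * n + 2 * (n * n)) ≡ 32 + 23 * n + 4 * (n * n) + (10 + 3 * n)
    eq = solve-∀

  D≤P : D ≤ P
  D≤P = ≤-by (11 + 10 * n + 2 * (n * n)) (eq n)
    where
    eq : ∀ n → 10 + 3 * n + (11 + 10 * n + 2 * (n * n)) ≡ 21 + 13 * n + 2 * (n * n)
    eq = solve-∀

  few-links : T * (a + q) ≤ P * b
  -- The witness is the difference of the two sides, expanded in n; starting from q = 6 makes all
  -- its coefficients nonnegative.
  few-links = ≤-by (59 + 146 * n + 114 * (n * n) + 36 * (n * n * n) + 4 * (n * n * n * n)) (eq n)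
    where
    eq : ∀ n → (32 + 23 * n + 4 * (n * n)) * ((2 + n) + (3 + n) * 2) +
               (59 + 146 * n + 114 * (n * n) + 36 * (n * n * n) + 4 * (n * n * n * n)) ≡
               (21 + 13 * n + 2 * (n * n)) * (15 + 11 * n + 2 * (n * n))
    eq = solve-∀

  high-degree : 3 * T + P ≤ P * q
  high-degree = ≤-by (9 + 38 * n + 24 * (n * n) + 4 * (n * n * n)) (eq n)
    where
    eq : ∀ n → 3 * (32 + 23 * n + 4 * (n * n)) + (21 + 13 * n + 2 * (n * n)) +
               (9 + 38 * n + 24 * (n * n) + 4 * (n * n * n)) ≡
               (21 + 13 * n + 2 * (n * n)) * ((3 + n) * 2)
    eq = solve-∀

  -- At the least possible x, (k − 1)(2q − k) / 2, the difference 2 (D x + P a − T k)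
  -- factors as (q − k)(D k − 6 + 5n + 2n²), and the second factor is X.
  separation : ∀ k x → 1 ≤ k → k ≤ q → 2 * q * k + k ≤ 2 * x + k * k + 2 * q → T * k ≤ D * x + P * a
  separation (suc j) x _ k≤q few = ℕₚ.*-cancelˡ-≤ 2 (ℕₚ.+-cancelʳ-≤ _ _ _ (begin
    -- The factor q - k ≥ 0 enters as k X ≤ q X, and the bound on x enters below, multiplied by D.
    2 * (T * k) + (D * (k * k + 2 * q) + k * X)        ≤⟨ ℕₚ.+-monoʳ-≤ (2 * (T * k)) (ℕₚ.+-monoʳ-≤ (D * (k * k + 2 * q)) (ℕₚ.*-monoˡ-≤ X k≤q)) ⟩
    2 * (T * k) + (D * (k * k + 2 * q) + q * X)        ≡⟨ identity n j ⟩
    2 * (P * a) + D * (2 * q * k + k) + k * X          ≤⟨ ℕₚ.+-monoˡ-≤ (k * X) (ℕₚ.+-monoʳ-≤ (2 * (P * a)) (ℕₚ.*-monoʳ-≤ D few)) ⟩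
    2 * (P * a) + D * (2 * x + k * k + 2 * q) + k * X  ≡⟨ regroup P a D x (k * k) (2 * q) (k * X) ⟩
    2 * (D * x + P * a) + (D * (k * k + 2 * q) + k * X) ∎))
    where
    open ℕₚ.≤-Reasoning
    k X : ℕ
    k = suc j
    -- Writing k = j + 1 absorbs the -6, so X is a natural number without subtraction.
    X = 4 + 8 * n + 2 * (n * n) + (10 + 3 * n) * j
    regroup : ∀ P a D x u v w → 2 * (P * a) + D * (2 * x + u + v) + w ≡ 2 * (D * x + P * a) + (D * (u + v) + w)
    regroup = solve-∀
    identity : ∀ n j →
      2 * ((32 + 23 * n + 4 * (n * n)) * suc j) +
        ((10 + 3 * n) * (suc j * suc j + 2 * ((3 + n) * 2)) + (3 + n) * 2 * (4 + 8 * n + 2 * (n * n) + (10 + 3 * n) * j)) ≡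
      2 * ((21 + 13 * n + 2 * (n * n)) * (2 + n)) + (10 + 3 * n) * (2 * ((3 + n) * 2) * suc j + suc j) +
        suc j * (4 + 8 * n + 2 * (n * n) + (10 + 3 * n) * j)
    identity = solve-∀

  2a<q : suc (a * 2) ≤ q
  2a<q = ℕₚ.n≤1+n (suc (a * 2))

  q²+q : q * q + q ≡ 2 * P
  q²+q = eq n
    where
    eq : ∀ n → (3 + n) * 2 * ((3 + n) * 2) + (3 + n) * 2 ≡ 2 * (21 + 13 * n + 2 * (n * n))
    eq = solve-∀

  a+q² : a + q * q ≡ T + q
  a+q² = eq n
    where
    eq : ∀ n → 2 + n + (3 + n) * 2 * ((3 + n) * 2) ≡ 32 + 23 * n + 4 * (n * n) + (3 + n) * 2
    eq = solve-∀

  b+q : b + q ≡ P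
  b+q = eq n
    where
    eq : ∀ n → 15 + 11 * n + 2 * (n * n) + (3 + n) * 2 ≡ 21 + 13 * n + 2 * (n * n)
    eq = solve-∀

  2q² : 2 * T + q + 2 ≡ 2 * q * q
  2q² = eq n
    where
    eq : ∀ n → 2 * (32 + 23 * n + 4 * (n * n)) + (3 + n) * 2 + 2 ≡ 2 * ((3 + n) * 2) * ((3 + n) * 2)
    eq = solve-∀

  open Network circulant a q r
  open NetworkCuts circulant a q r using (Bounds)
  open NetworkToughness circulant a q r

  bounds : Bounds P T D
  bounds = record
    { 2P≡T+D      = 2P≡T+D
    ; D≤P         = D≤P
    ; 1≤q         = s≤s z≤n
    ; r-large     = subst (λ b → 18 * (a + b + q * 13) ≤ r) (sym links) (ℕₚ.n≤1+n _)
    ; few-links   = subst (λ b → T * (a + q) ≤ P * b) (sym links) few-links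
    ; high-degree = high-degree
    ; separation  = separation
    }

  numerator : ℤ.+ 2 ℤ.* ℤ.+ q ℤ.* ℤ.+ q ℤ.- ℤ.+ q ℤ.- ℤ.+ 2 ≡ ℤ.+ (2 * T)
  numerator = begin
    ℤ.+ 2 ℤ.* ℤ.+ q ℤ.* ℤ.+ q ℤ.- ℤ.+ q ℤ.- ℤ.+ 2     ≡⟨ cong (λ z → z ℤ.- ℤ.+ q ℤ.- ℤ.+ 2) (pos-** 2 q q) ⟨
    ℤ.+ (2 * q * q) ℤ.- ℤ.+ q ℤ.- ℤ.+ 2               ≡⟨ cong (λ z → ℤ.+ z ℤ.- ℤ.+ q ℤ.- ℤ.+ 2) 2q² ⟨
    ℤ.+ (2 * T + q + 2) ℤ.- ℤ.+ q ℤ.- ℤ.+ 2           ≡⟨ cong (λ z → z ℤ.- ℤ.+ q ℤ.- ℤ.+ 2)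
                                                           (trans (ℤₚ.pos-+ (2 * T + q) 2) (cong (ℤ._+ ℤ.+ 2) (ℤₚ.pos-+ (2 * T) q))) ⟩
    ℤ.+ (2 * T) ℤ.+ ℤ.+ q ℤ.+ ℤ.+ 2 ℤ.- ℤ.+ q ℤ.- ℤ.+ 2 ≡⟨ cancel (ℤ.+ (2 * T)) (ℤ.+ q) ⟩
    ℤ.+ (2 * T)                                       ∎
    where
    open ≡-Reasoning
    cancel : ∀ t q → t ℤ.+ q ℤ.+ ℤ.+ 2 ℤ.- q ℤ.- ℤ.+ 2 ≡ t
    cancel = ℤ-Solver.solve-∀

  -- The ratio is T / P, written with both terms doubled because q² + q = 2P.
  network-toughness : .{{_ : NonZero (q * q + q)}} → IsToughness network [ ℤ.+ (2 * T) / (q * q + q) ]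
  network-toughness = isToughness network {2 * T} {q * q + q} bound criticalSet (criticalSet-components zero)
    (ℕₚ.≤-trans (s≤s (s≤s z≤n)) (ℕₚ.≤-reflexive (sym components≡P))) tight
    where
    components≡P : size {Pair q ⊎ Fin q} ≡ P
    components≡P = trans (cong (_+ q) (trans (sym (trans (∑-const {Pair q} 1) (ℕₚ.*-identityʳ (size {Pair q})))) links)) b+q
    ∣S∣≡T : ∣ criticalSet ∣ ≡ T
    ∣S∣≡T = ℕₚ.+-cancelʳ-≡ q _ _ (trans ∣criticalSet∣ a+q²)
    tight : (q * q + q) * ∣ criticalSet ∣ ≤ 2 * T * size {Pair q ⊎ Fin q}
    tight = ℕₚ.≤-reflexive (begin
      (q * q + q) * ∣ criticalSet ∣    ≡⟨ cong₂ _*_ q²+q ∣S∣≡T ⟩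
      2 * P * T                        ≡⟨ swap P T ⟩
      2 * T * P                        ≡⟨ cong (2 * T *_) components≡P ⟨
      2 * T * size {Pair q ⊎ Fin q}    ∎)
      where
      open ≡-Reasoning
      swap : ∀ P T → 2 * P * T ≡ 2 * T * P
      swap = solve-∀
    bound : ∀ S c → HasComponents (network ∖ S) c → 2 ≤ c → 2 * T * c ≤ (q * q + q) * ∣ S ∣
    bound S c components 2≤c = begin
      2 * T * c                 ≡⟨ ℕₚ.*-assoc 2 T c ⟩
      2 * (T * c)               ≤⟨ ℕₚ.*-monoʳ-≤ 2 (cut-bound bounds S c components 2≤c) ⟩
      2 * (P * ∣ S ∣)           ≡⟨ ℕₚ.*-assoc 2 P ∣ S ∣ ⟨
      2 * P * ∣ S ∣             ≡⟨ cong (_* ∣ S ∣) q²+q ⟨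
      (q * q + q) * ∣ S ∣       ∎
      where open ℕₚ.≤-Reasoning

-- The two forms of the ratio, and the conclusion.

difference : ∀ q → ℤ.+ 2 ℤ.* ℤ.+ q ℤ.* ℤ.+ q ℤ.- ℤ.+ q ℤ.- ℤ.+ 2 ≡
                   ℤ.+ 2 ℤ.* ℤ.+ (q * q + q) ℤ.- ℤ.+ (3 * q + 2)
difference q = begin
  ℤ.+ 2 ℤ.* ℤ.+ q ℤ.* ℤ.+ q ℤ.- ℤ.+ q ℤ.- ℤ.+ 2
    ≡⟨ expand (ℤ.+ q) ⟩
  ℤ.+ 2 ℤ.* (ℤ.+ q ℤ.* ℤ.+ q ℤ.+ ℤ.+ q) ℤ.- (ℤ.+ 3 ℤ.* ℤ.+ q ℤ.+ ℤ.+ 2)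
    ≡⟨ cong₂ (λ x y → ℤ.+ 2 ℤ.* x ℤ.- y)
         (trans (ℤₚ.pos-+ (q * q) q) (cong (ℤ._+ ℤ.+ q) (ℤₚ.pos-* q q)))
         (trans (ℤₚ.pos-+ (3 * q) 2) (cong (ℤ._+ ℤ.+ 2) (ℤₚ.pos-* 3 q))) ⟨
  ℤ.+ 2 ℤ.* ℤ.+ (q * q + q) ℤ.- ℤ.+ (3 * q + 2) ∎
  where
  open ≡-Reasoning
  expand : ∀ q → ℤ.+ 2 ℤ.* q ℤ.* q ℤ.- q ℤ.- ℤ.+ 2 ≡
                 ℤ.+ 2 ℤ.* (q ℤ.* q ℤ.+ q) ℤ.- (ℤ.+ 3 ℤ.* q ℤ.+ ℤ.+ 2)
  expand = ℤ-Solver.solve-∀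

open import Data.Integer using (+_)

theorem1p1 : (q : ℕ) → 2 ∣ q → (6≤q : 6 ℕ.≤ q) →
    let instance
          nz : NonZero (q ℕ.* q ℕ.+ q)
          nz = q²+q-nonZero 6≤q
        τ = (+ 2 ℤ.* + q ℤ.* + q ℤ.- + q ℤ.- + 2) / (q ℕ.* q ℕ.+ q)
    in Σ[ n ∈ ℕ ] Σ[ G ∈ Graph (Fin n) ]
         TriangleFree G
         × ¬ HasTwoFactor G
         × IsToughness G [ τ ]
         × τ ≡ + 2 / 1 ℚ.- (+ (3 ℕ.* q ℕ.+ 2)) / (q ℕ.* q ℕ.+ q)
-- Writing q = 2m, the values m < 3 contradict 6 ≤ q; otherwise m = n + 3, as in `Parameters`.
theorem1p1 _ (divides 0 refl) ()
theorem1p1 _ (divides 1 refl) (s≤s (s≤s ()))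
theorem1p1 _ (divides 2 refl) (s≤s (s≤s (s≤s (s≤s ()))))
theorem1p1 _ (divides (suc (suc (suc n))) refl) 6≤q =
  _ , network , network-triangle-free , no-two-factor {3 + n} refl 2a<q ,
  subst (λ z → IsToughness network [ (z / (q * q + q)) {{nz}} ]) (sym numerator) (network-toughness {{nz}}) ,
  /-minus {j = ℤ.+ (3 * q + 2)} {k = ℤ.+ 2} (q * q + q) {{nz}} (difference q)
  where
  open Parameters n
  open Network circulant a q r
  nz : NonZero (q * q + q)
  nz = q²+q-nonZero 6≤q
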